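{- Let $P\subseteq X$ be a point set of size $n$ in a metric space $(X,\mathrm{dist})$ of doubling dimension $d$, where $d$ is a constant. Let $k,z\in\mathbb{N}$ be two natural numbers, and let $0<\varepsilon\le1$ be an error parameter. Assuming $P$ is initially distributed randomly over the machines, there exists a randomized algorithm that (with high probability) computes an $(\varepsilon,k,z)$-coreset of $P$ in the MPC model in one round of communication, using $m=O(\sqrt{n\varepsilon^d/k})$ worker machines with $O(\sqrt{nk/\varepsilon^d})$ local memory, and a coordinator with $O(\sqrt{nk/\varepsilon^d}+\sqrt{n\varepsilon^d/k}\cdot\min(\log n,z)+z)$ local memory.
   Context: Problem. For a point set $P$ in $(X,\mathrm{dist})$, possibly with positive integer weights (unweighted points have weight $1$), $\mathrm{opt}_{k,z}(P)$ is the minimum radius of $k$ congruent balls (centers in $X$) covering all points of $P$ except for outliers of total weight at most $z$; $b(c,r)=\{q\in X:\mathrm{dist}(c,q)\le r\}$. The doubling dimension of $(X,\mathrm{dist})$ is the smallest $d$ such that any ball of radius $\rho$ can be covered by $2^d$ balls of radius $\rho/2$. $O(\cdot)$ hides constants depending only on $d$. Coreset. A weighted subset $P^*\subseteq P$ (weights may differ from those in $P$) is an $(\varepsilon,k,z)$-coreset of $P$ if (1) $(1-\varepsilon)\,\mathrm{opt}_{k,z}(P)\le \mathrm{opt}_{k,z}(P^*)\le(1+\varepsilon)\,\mathrm{opt}_{k,z}(P)$; and (2) for any set $\{b(c_1,r),\dots,b(c_k,r)\}$ of congruent balls in $X$ such that the total weight of the points of $P^*$ not covered by them is at most $z$, the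 total weight of the points of $P$ not covered by $b(c_1,r'),\dots,b(c_k,r')$, with $r'=r+\varepsilon\cdot\mathrm{opt}_{k,z}(P)$, is at most $z$. MPC model. The input is initially partitioned into disjoint sets $P_1,\dots,P_m$ over machines $M_1,\dots,M_m$. Computation proceeds in synchronous rounds: in each round each machine performs an arbitrary local computation and sends messages to other machines; communication rounds are counted. One designated machine, the coordinator, must contain the answer at the end (after a final local computation); the others are workers. Local memory is measured in the number of stored points/numbers. "Distributed randomly" means each point of $P$ is assigned independently and uniformly at random to one of the $m$ machines; this is the only source of randomness. "With high probability" means with probability at least $1-1/n^2$. -}

module Defs where

open import Level using (Level) renaming (suc to lsuc)
open import Algebra.Bundles using (CommutativeRing; Semiring)
import Algebra.Definitions.RawSemiring as RawSemiringDefinitions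
import Algebra.Properties.Ring as RingProperties
open import Data.Fin.Base using (Fin; zero; suc)
import Data.Fin.Properties as Fin
open import Data.List.Base
  using (List; _++_; length; map; filter; concatMap; sum; allFin)
open import Data.List.Relation.Binary.Subset.Propositional using (_⊆_)
open import Data.List.Relation.Unary.All using (All)
open import Data.List.Relation.Unary.Unique.Propositional using (Unique)
open import Data.Nat.Base as ℕ using (ℕ)
open import Data.Product.Base using (Σ; ∃; _×_; _,_; proj₁; proj₂)
open import Data.Sum.Base using (_⊎_; inj₁; inj₂)
open import Data.Vec.Base using (Vec; lookup)
open import Function.Base using (_∘_)
open import Function.Bundles using (_↣_; Injection)
open import Function.Metric.Structures using (IsGeneralMetric)
open import Relation.Binary.Core using (Rel)
open import Relation.Binary.Bundles using (DecTotalOrder)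
import Relation.Binary.Construct.NonStrictToStrict as NonStrictToStrict
open import Relation.Binary.PropositionalEquality.Core using (_≡_)
open import Relation.Binary.Structures using (IsDecTotalOrder)
open import Relation.Nullary.Decidable.Core using (Dec)
open import Relation.Nullary.Negation.Core using (¬_)
open import Relation.Nullary.Decidable using (¬?)
open import Relation.Unary using (Pred)

-- Dedekind-complete ordered fields.  Classically ℝ is the only one up to
-- isomorphism.  A decidable order is a field of the record because it cannot
-- be derived constructively.

record CompleteOrderedField (ℓ : Level) : Set (lsuc ℓ) where
  infix  4 _≤_
  infix  9 _⁻¹
  field
    commutativeRing : CommutativeRing ℓ ℓ

  open CommutativeRing commutativeRing public hiding (zero)

  field
    _≤_             : Rel Carrier ℓ
    isDecTotalOrder : IsDecTotalOrder _≈_ _≤_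

  decTotalOrder : DecTotalOrder ℓ ℓ ℓ
  decTotalOrder = record { isDecTotalOrder = isDecTotalOrder }

  open IsDecTotalOrder isDecTotalOrder public
    using (_≟_; _≤?_; total; ≤-resp-≈; antisym)
    renaming (refl to ≤-refl; reflexive to ≤-reflexive; trans to ≤-trans)

  IsUpperBound : Pred Carrier ℓ → Carrier → Set ℓ
  IsUpperBound S u = ∀ x → S x → x ≤ u

  IsLowerBound : Pred Carrier ℓ → Carrier → Set ℓ
  IsLowerBound S l = ∀ x → S x → l ≤ x

  IsSupremum : Pred Carrier ℓ → Carrier → Set ℓ
  IsSupremum S s = IsUpperBound S s × (∀ u → IsUpperBound S u → s ≤ u)

  IsInfimum : Pred Carrier ℓ → Carrier → Set ℓ
  IsInfimum S s = IsLowerBound S s × (∀ l → IsLowerBound S l → l ≤ s)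

  field
    0≉1      : ¬ (0# ≈ 1#)
    +-mono-≤ : ∀ {x y} z → x ≤ y → x + z ≤ y + z
    *-nonNeg : ∀ {x y} → 0# ≤ x → 0# ≤ y → 0# ≤ x * y
    -- The value of 0# ⁻¹ is unspecified.
    _⁻¹      : Carrier → Carrier
    inverse  : ∀ x → ¬ (x ≈ 0#) → x * x ⁻¹ ≈ 1#
    complete : (S : Pred Carrier ℓ) → ∃ S → ∃ (IsUpperBound S) → ∃ (IsSupremum S)

  open NonStrictToStrict _≈_ _≤_ public using (_<_)
  open RawSemiringDefinitions (Semiring.rawSemiring semiring) public using (_^_) renaming (_×_ to _·_)

  fromℕ : ℕ → Carrier
  fromℕ n = n · 1#

  half : Carrier → Carrier
  half x = x * (1# + 1#) ⁻¹

  private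
    open RingProperties ring using (-‿involutive; -‿distribˡ-*; -‿distribʳ-*)

    sub-nonNeg : ∀ {x y} → x ≤ y → 0# ≤ y + - x
    sub-nonNeg {x} x≤y =
      ≤-trans (≤-reflexive (sym (-‿inverseʳ x))) (+-mono-≤ (- x) x≤y)

    0≤1 : 0# ≤ 1#
    0≤1 with total 0# 1#
    ... | inj₁ p = p
    ... | inj₂ q = ≤-trans (*-nonNeg 0≤-1 0≤-1) (≤-reflexive eq)
      where
      0≤-1 : 0# ≤ - 1#
      0≤-1 = ≤-trans (sub-nonNeg q) (≤-reflexive (+-identityˡ (- 1#)))
      eq : - 1# * - 1# ≈ 1#
      eq = trans (sym (-‿distribˡ-* 1# (- 1#)))
                 (trans (-‿cong (*-identityˡ (- 1#))) (-‿involutive 1#))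

    ≤-square : ∀ {t} → 1# ≤ t → t ≤ t * t
    ≤-square {t} 1≤t =
      ≤-trans (≤-reflexive (sym (+-identityˡ t)))
        (≤-trans (+-mono-≤ t (*-nonNeg (sub-nonNeg 1≤t) (≤-trans 0≤1 1≤t)))
                 (≤-reflexive eq))
      where
      eq : (t + - 1#) * t + t ≈ t * t
      eq = trans (+-cong (trans (distribʳ t t (- 1#))
                   (+-cong refl (trans (sym (-‿distribˡ-* 1# t)) (-‿cong (*-identityˡ t))))) refl)
             (trans (+-assoc (t * t) (- t) t)
               (trans (+-cong refl (-‿inverseˡ t)) (+-identityʳ (t * t))))

    BelowRoot : Carrier → Pred Carrier ℓ
    BelowRoot x t = t ≤ 0# ⊎ t * t ≤ x

    belowRoot-bounded : ∀ x → ∃ (IsUpperBound (BelowRoot x))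
    belowRoot-bounded x with total 1# x
    ... | inj₁ 1≤x = x , bound
      where
      bound : IsUpperBound (BelowRoot x) x
      bound t (inj₁ t≤0) = ≤-trans t≤0 (≤-trans 0≤1 1≤x)
      bound t (inj₂ tt≤x) with total 1# t
      ... | inj₁ 1≤t = ≤-trans (≤-square 1≤t) tt≤x
      ... | inj₂ t≤1 = ≤-trans t≤1 1≤x
    ... | inj₂ x≤1 = 1# , bound
      where
      bound : IsUpperBound (BelowRoot x) 1#
      bound t (inj₁ t≤0) = ≤-trans t≤0 0≤1
      bound t (inj₂ tt≤x) with total 1# t
      ... | inj₁ 1≤t = ≤-trans (≤-square 1≤t) (≤-trans tt≤x x≤1)
      ... | inj₂ t≤1 = t≤1

    root : ∀ x → ∃ (IsSupremum (BelowRoot x))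
    root x = complete (BelowRoot x) (0# , inj₁ ≤-refl) (belowRoot-bounded x)

  -- The disjunct t ≤ 0 makes the set nonempty for every x, so that √ is total:
  -- √ x = 0 for x < 0.
  √ : Carrier → Carrier
  √ x = proj₁ (root x)

  √-isSupremum : ∀ x → IsSupremum (λ t → t ≤ 0# ⊎ t * t ≤ x) (√ x)
  √-isSupremum x = proj₂ (root x)

module _ {ℓ : Level} (ℝ : CompleteOrderedField ℓ) where

  open CompleteOrderedField ℝ

  record MetricSpace : Set (lsuc ℓ) where
    field
      Point    : Set ℓ
      dist     : Point → Point → Carrier
      isMetric : IsGeneralMetric _≡_ _≈_ _≤_ 0# _+_ dist

module _ {ℓ : Level} {ℝ : CompleteOrderedField ℓ} (X : MetricSpace ℝ) where

  open CompleteOrderedField ℝ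
  open MetricSpace X

  InBall : Point → Carrier → Point → Set ℓ
  InBall c r q = dist c q ≤ r

  InBalls : {k : ℕ} → (Fin k → Point) → Carrier → Point → Set ℓ
  InBalls c r q = ∃ λ i → InBall (c i) r q

  inBalls? : {k : ℕ} (c : Fin k → Point) (r : Carrier) (q : Point) → Dec (InBalls c r q)
  inBalls? c r q = Fin.any? (λ i → dist (c i) q ≤? r)

  Doubling : ℕ → Set ℓ
  Doubling d = ∀ (p : Point) (ρ : Carrier) → 0# ≤ ρ →
    Σ (Fin (2 ℕ.^ d) → Point) λ c → ∀ q → InBall p ρ q → InBalls c (half ρ) q

  HasDoublingDimension : ℕ → Set ℓ
  HasDoublingDimension d = Doubling d × (∀ d′ → Doubling d′ → d ℕ.≤ d′)

  WeightedPoints : Set ℓ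
  WeightedPoints = List (Point × ℕ)

  IsWeightedSet : WeightedPoints → Set ℓ
  IsWeightedSet A = Unique (map proj₁ A) × All (λ a → 1 ℕ.≤ proj₂ a) A

  uncoveredWeight : {k : ℕ} → (Fin k → Point) → Carrier → WeightedPoints → ℕ
  uncoveredWeight c r A =
    sum (map proj₂ (filter (λ a → ¬? (inBalls? c r (proj₁ a))) A))

  Feasible : (k z : ℕ) → WeightedPoints → Pred Carrier ℓ
  Feasible k z A r =
    0# ≤ r × (Σ (Fin k → Point) λ c → uncoveredWeight c r A ℕ.≤ z)

  -- An infimum, since the minimum over centres in X need not be attained.
  IsOpt : (k z : ℕ) → WeightedPoints → Carrier → Set ℓ
  IsOpt k z A = IsInfimum (Feasible k z A)

  IsCoreset : Carrier → (k z : ℕ) → (A A* : WeightedPoints) → Set ℓ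
  IsCoreset ε k z A A* =
    IsWeightedSet A* × map proj₁ A* ⊆ map proj₁ A ×
    Σ Carrier λ opt → Σ Carrier λ opt* →
      IsOpt k z A opt × IsOpt k z A* opt* ×
      (1# + - ε) * opt ≤ opt* × opt* ≤ (1# + ε) * opt ×
      (∀ (c : Fin k → Point) (r : Carrier) → 0# ≤ r →
        uncoveredWeight c r A* ℕ.≤ z →
        uncoveredWeight c (r + ε * opt) A ℕ.≤ z)

  unitWeights : {n : ℕ} → Fin n ↣ Point → WeightedPoints
  unitWeights {n} P = map (λ j → Injection.to P j , 1) (allFin n)

-- Local memory is counted in words; a word is one point or one number.
data Word {ℓ : Level} (A : Set ℓ) : Set ℓ where
  point  : A → Word A
  number : ℕ → Word A

Memory : {ℓ : Level} → Set ℓ → Set ℓ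
Memory A = List (Word A)

-- The result of one local computation: what the machine keeps, and the message
-- it sends to each machine.
record Step {ℓ : Level} (A : Set ℓ) (m : ℕ) : Set ℓ where
  field
    kept : Memory A
    send : Fin m → Memory A

-- Algorithm A m t: MPC algorithms on m machines with t communication rounds,
-- each preceded by a local computation and the last one followed by the
-- coordinator's final local computation, which outputs a weighted point set.
data Algorithm {ℓ : Level} (A : Set ℓ) (m : ℕ) : ℕ → Set ℓ where
  finish : (Memory A → List (A × ℕ)) → Algorithm A m 0
  round  : {t : ℕ} → (Fin m → Memory A → Step A m) → Algorithm A m t →
           Algorithm A m (ℕ.suc t)

module _ {ℓ : Level} {A : Set ℓ} where

  deliver : {m : ℕ} → (Fin m → Step A m) → Fin m → Memory A
  deliver {m} s i = Step.kept (s i) ++ concatMap (λ j → Step.send (s j) i) (allFin m)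

  -- Machine zero is the coordinator, the w others are the workers.
  output : {w t : ℕ} → Algorithm A (ℕ.suc w) t →
           (Fin (ℕ.suc w) → Memory A) → List (A × ℕ)
  output (finish f)  mem = f (mem zero)
  output (round s a) mem = output a (deliver (λ i → s i (mem i)))

  -- The memory used by a machine is the maximum over its local computations of
  -- the words read plus the words kept, sent or output.  A weighted point in
  -- the output takes two words.
  memoryUse : {w t : ℕ} → Algorithm A (ℕ.suc w) t →
              (Fin (ℕ.suc w) → Memory A) → Fin (ℕ.suc w) → ℕ
  memoryUse (finish f)  mem zero    = length (mem zero) ℕ.+ 2 ℕ.* length (f (mem zero))
  memoryUse (finish f)  mem (suc i) = length (mem (suc i))
  memoryUse {w} (round s a) mem i =
    (length (mem i) ℕ.+ length (Step.kept (s i (mem i)))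
      ℕ.+ sum (map (λ j → length (Step.send (s i (mem i)) j)) (allFin (ℕ.suc w))))
    ℕ.⊔ memoryUse a (deliver (λ j → s j (mem j))) i

  -- The assignment a sends the j-th point of P to machine (lookup a j).
  initialMemory : {n m : ℕ} → Fin n ↣ A → Vec (Fin m) n → Fin m → Memory A
  initialMemory {n} P a i =
    map (point ∘ Injection.to P) (filter (λ j → lookup a j Fin.≟ i) (allFin n))

-- The event E has probability at least 1 - 1/n² under the uniform distribution
-- on the m ^ n assignments of n points to m machines: E contains a set of g
-- assignments with m ^ n - m ^ n / n² ≤ g, stated without subtraction and
-- division.
WithHighProbability : {ℓ : Level} {m : ℕ} (n : ℕ) → (Vec (Fin m) n → Set ℓ) → Set ℓ
WithHighProbability {m = m} n E =
  Σ (List (Vec (Fin m) n)) λ good → Unique good × All E good ×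
    n ℕ.^ 2 ℕ.* m ℕ.^ n ℕ.≤ m ℕ.^ n ℕ.+ n ℕ.^ 2 ℕ.* length good

module Submission where

-- Each machine sends a greedy net of its points, weighted by the number of points assigned to each
-- net point, with the smallest radius for which the net has at most B = K + z′ points, where
-- K = O(k / ε ^ d) and z′ = min(O(z / m + log n), z).  A set of outliers Z that is optimal for all
-- of P is split evenly by the random distribution (Chernoff), so at most z′ points of Z lie on each
-- machine.  By the doubling property an ε opt-separated set contains at most K points outside Z,
-- so every machine reaches radius ε opt.  Moving points by at most ε opt while keeping their weight
-- yields a coreset, and the union of the m = O(√(n ε ^ d / k)) nets fits on the coordinator.

open import Defs
open import Data.Bool.Base using (Bool; true; false; if_then_else_)
import Data.Bool.Properties as Bool
open import Data.Fin using (Fin; zero; suc)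
open import Data.Fin.Base as Fin using (remQuot; combine)
import Data.Fin.Properties as Fin
open import Data.Fin.Subset using (Subset; inside; outside; ∣_∣; ⊤)
import Data.Fin.Subset.Properties as Subset
open import Data.List.Base
  using (List; []; _∷_; _++_; map; filter; length; allFin; concat; concatMap; cartesianProductWith)
import Data.List.Base as List
open import Data.List.Membership.Propositional using (_∈_)
open import Data.List.Membership.Propositional.Properties
  using (∈-lookup; ∈-allFin; ∈-map⁺; ∈-map⁻; ∈-filter⁻; ∈-concat⁻′; ∈-cartesianProductWith⁺; ∈-cartesianProductWith⁻)
open import Data.List.Properties
  using (map-tabulate; map-++; map-cong; map-∘; map-concatMap; length-++; length-map; length-filter; length-tabulate; filter-++; filter-none)
open import Data.List.Relation.Binary.Disjoint.Propositional using (Disjoint)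
import Data.List.Relation.Binary.Sublist.Heterogeneous.Properties as Sublist
open import Data.List.Relation.Binary.Sublist.Propositional using ([]; _∷_; _∷ʳ_) renaming (_⊆_ to _⊑_)
open import Data.List.Relation.Binary.Subset.Propositional using (_⊆_)
open import Data.List.Relation.Unary.All as All using (All; []; _∷_)
import Data.List.Relation.Unary.All.Properties as All
open import Data.List.Relation.Unary.AllPairs as AllPairs using (AllPairs; []; _∷_)
import Data.List.Relation.Unary.AllPairs.Properties as AllPairs
open import Data.List.Relation.Unary.Any using (here; there)
open import Data.List.Relation.Unary.Unique.Propositional using (Unique)
import Data.List.Relation.Unary.Unique.Propositional.Properties as Unique
open import Data.Nat using (ℕ; suc; NonZero; _⊓_)
open import Data.Nat.Base as ℕ using (zero)
open import Data.Nat.DivMod using (_/_; _%_; m/n*n≤m; m%n<n; m≡m%n+[m/n]*n)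
open import Data.Nat.Induction using (<-rec)
open import Data.Nat.ListAction using (sum)
open import Data.Nat.ListAction.Properties using (sum-++)
open import Data.Nat.Logarithm using (⌊log₂_⌋; ⌊log₂⌋-mono-≤; ⌊log₂⌊n/2⌋⌋≡⌊log₂n⌋∸1; ⌊log₂[2^n]⌋≡n)
import Data.Nat.Properties as ℕ
open import Data.Nat.Tactic.RingSolver using (solve-∀)
open import Data.Product using (Σ; ∃; _×_; _,_; proj₁; proj₂)
open import Data.Sum.Base using (_⊎_; inj₁; inj₂)
open import Data.Vec.Base as Vec using (Vec; []; _∷_; lookup)
import Data.Vec.Properties as Vec
open import Function.Base using (_∘_; id)
open import Function.Bundles using (_↣_; Injection)
open import Function.Metric.Structures using (IsGeneralMetric)
open import Level using (Level)
open import Relation.Binary.Bundles using (DecTotalOrder)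
open import Relation.Binary.PropositionalEquality as ≡ using (_≡_; _≢_)
open import Relation.Nullary.Decidable using (Dec; does; yes; no; ¬?; decidable-stable; dec-true; _×-dec_)
open import Relation.Nullary.Negation using (¬_; contradiction)
open import Relation.Unary using (Pred; Decidable)

-- The algorithm is fixed before `P` and never sees the optimum or an outlier set; it compares only
-- distances between the points on a machine, while the analysis may use both. What shapes the proof
-- is that the optimum is an infimum that need not be attained, and that the field supplies weak
-- excluded middle but no witnesses: covers of radius r > opt, and exponents j with 2 ≤ ε 2 ^ j ≤ 4,
-- are available only up to double negation. The bounds drawn from them are inequalities between
-- naturals or field elements, hence stable, so the double negations can be removed. With about √(n
-- / K) machines, the mean load n / m and the total m K of regular net points are both of order √(n
-- K); the remaining m z′ yields the terms with log n and z. Rounding 2 / ε up to a power of two, at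
-- most 4 / ε, makes K as large as 4 ^ d k / ε ^ d, and the root of 4 ^ d is the factor 2 ^ d in the
-- constant.

private
  variable
    a p q : Level
    A : Set a

-- Probability by counting: Markov's inequality and the union bound.

module Counting where

  open import Data.Nat.Base
  open import Data.Nat.Properties
  open ≡ using (refl; sym; trans; cong; cong₂; subst; subst₂; module ≡-Reasoning)

  module _ {a p} {A : Set a} {P : Pred A p} (P? : Decidable P) where

    count : List A → ℕ
    count xs = length (filter P? xs)

    indicator : A → ℕ
    indicator x = if does (P? x) then 1 else 0

    count-∷ : ∀ x xs → count (x ∷ xs) ≡ indicator x + count xs
    count-∷ x xs with does (P? x)
    ... | false = refl
    ... | true  = refl

    count-complement : ∀ xs → count xs + length (filter (¬? ∘ P?) xs) ≡ length xs
    count-complement [] = refl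
    count-complement (x ∷ xs) with does (P? x)
    ... | false = trans (+-suc _ _) (cong suc (count-complement xs))
    ... | true  = cong suc (count-complement xs)

    markov : ∀ (f : A → ℕ) t → (∀ x → P x → t ≤ f x) →
             ∀ xs → t * count xs ≤ sum (map f xs)
    markov f t h [] = ≤-reflexive (*-zeroʳ t)
    markov f t h (x ∷ xs) with P? x
    ... | no  _  = ≤-trans (markov f t h xs) (m≤n+m _ (f x))
    ... | yes px = ≤-trans (≤-reflexive (*-suc t _)) (+-mono-≤ (h x px) (markov f t h xs))

  module _ {a b p} {A : Set a} {B : Set b} {P : Pred B p} (P? : Decidable P) (f : A → B) where

    filter-map : ∀ xs → filter P? (map f xs) ≡ map f (filter (P? ∘ f) xs)
    filter-map [] = refl
    filter-map (x ∷ xs) with does (P? (f x))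
    ... | false = filter-map xs
    ... | true  = cong (f x ∷_) (filter-map xs)

    count-map : ∀ xs → count P? (map f xs) ≡ count (P? ∘ f) xs
    count-map xs = trans (cong length (filter-map xs)) (length-map f (filter (P? ∘ f) xs))

  module _ {a p q} {A : Set a} {P : Pred A p} {Q : Pred A q}
           (P? : Decidable P) (Q? : Decidable Q) where

    count-mono : (∀ x → P x → Q x) → ∀ xs → count P? xs ≤ count Q? xs
    count-mono h [] = z≤n
    count-mono h (x ∷ xs) with P? x | Q? x
    ... | no  _  | no  _  = count-mono h xs
    ... | no  _  | yes _  = m≤n⇒m≤1+n (count-mono h xs)
    ... | yes px | no ¬qx = contradiction (h x px) ¬qx
    ... | yes _  | yes _  = s≤s (count-mono h xs)

  module _ {a b p} {A : Set a} {B : Set b} {P : B → A → Set p}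
           (P? : ∀ i x → Dec (P i x)) where

    all? : ∀ is x → Dec (All (λ i → P i x) is)
    all? is x = All.all? (λ i → P? i x) is

    -- The union bound, scaled by c so that the probabilities N / c stay integral.
    union-bound : ∀ c N xs → (∀ i → c * count (¬? ∘ P? i) xs ≤ N) →
                  ∀ is → c * length xs ≤ c * count (all? is) xs + length is * N
    union-bound c N xs h [] =
      ≤-reflexive (trans (cong (c *_) (sym (full xs))) (sym (+-identityʳ _)))
      where
      full : ∀ xs → count (all? []) xs ≡ length xs
      full [] = refl
      full (x ∷ xs) = cong suc (full xs)
    union-bound c N xs h (i ∷ is) = begin
      c * length xs                                    ≤⟨ union-bound c N xs h is ⟩
      c * count (all? is) xs + length is * N           ≤⟨ +-monoˡ-≤ _ (*-monoʳ-≤ c (split xs)) ⟩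
      c * (count (all? (i ∷ is)) xs + count (¬? ∘ P? i) xs) + length is * N
                                                       ≡⟨ regroup c _ (count (¬? ∘ P? i) xs) _ ⟩
      c * count (all? (i ∷ is)) xs + (c * count (¬? ∘ P? i) xs + length is * N)
                                                       ≤⟨ +-monoʳ-≤ (c * count (all? (i ∷ is)) xs) (+-monoˡ-≤ _ (h i)) ⟩
      c * count (all? (i ∷ is)) xs + (N + length is * N) ∎
      where
      open ≤-Reasoning
      regroup : ∀ c x y z → c * (x + y) + z ≡ c * x + (c * y + z)
      regroup = solve-∀
      split : ∀ xs → count (all? is) xs ≤ count (all? (i ∷ is)) xs + count (¬? ∘ P? i) xs
      split [] = z≤n
      split (x ∷ xs) with P? i x | All.all? (λ i → P? i x) is
      ... | yes _ | yes _ = s≤s (split xs)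
      ... | yes _ | no  _ = split xs
      ... | no  _ | yes _ = ≤-trans (s≤s (split xs)) (≤-reflexive (sym (+-suc _ _)))
      ... | no  _ | no  _ = ≤-trans (split xs) (+-monoʳ-≤ (count (all? (i ∷ is)) xs) (n≤1+n _))

  allFin-suc : ∀ n → allFin (suc n) ≡ zero ∷ map suc (allFin n)
  allFin-suc n = cong (zero ∷_) (sym (map-tabulate id suc))

  length-allFin : ∀ n → length (allFin n) ≡ n
  length-allFin n = length-tabulate {n = n} id

  sum-scale : ∀ {a} {A : Set a} c (f : A → ℕ) xs → sum (map (λ x → c * f x) xs) ≡ c * sum (map f xs)
  sum-scale c f [] = sym (*-zeroʳ c)
  sum-scale c f (x ∷ xs) = trans (cong (c * f x +_) (sum-scale c f xs)) (sym (*-distribˡ-+ c _ _))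

  -- The Chernoff bound for uniformly random assignments.

  module _ {m : ℕ} where

    assignments : ∀ n → List (Vec (Fin m) n)
    assignments zero    = [] ∷ []
    assignments (suc n) = cartesianProductWith Vec._∷_ (allFin m) (assignments n)

    length-product : ∀ {n} (xs : List (Fin m)) (ys : List (Vec (Fin m) n)) →
                     length (cartesianProductWith Vec._∷_ xs ys) ≡ length xs * length ys
    length-product [] ys = refl
    length-product (x ∷ xs) ys =
      trans (length-++ (map (Vec._∷_ x) ys)) (cong₂ _+_ (length-map (Vec._∷_ x) ys) (length-product xs ys))

    length-assignments : ∀ n → length (assignments n) ≡ m ^ n
    length-assignments zero = refl
    length-assignments (suc n) =
      trans (length-product (allFin m) (assignments n))
            (cong₂ _*_ (length-allFin m) (length-assignments n))

    assignments-unique : ∀ n → Unique (assignments n)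
    assignments-unique zero    = [] ∷ []
    assignments-unique (suc n) =
      Unique.cartesianProductWith⁺ Vec._∷_ Vec.∷-injective (Unique.allFin⁺ m) (assignments-unique n)

    machine : ∀ {n} → Vec (Fin m) n → Fin m → List (Fin n)
    machine {n} a i = filter (λ j → lookup a j Fin.≟ i) (allFin n)

    -- The count runs over `machine a i`, so for the full subset it is the load of machine `i`.
    -- Outliers and loads thus share one tail bound.
    hits : ∀ {n} → Fin m → Subset n → Vec (Fin m) n → ℕ
    hits i Z a = count (λ j → lookup Z j Bool.≟ inside) (machine a i)

    hit : Fin m → Bool → Fin m → ℕ
    hit i s x = if does (x Fin.≟ i) then indicator (Bool._≟ inside) s else 0

    hits-∷ : ∀ {n} i s (Z : Subset n) x a → hits i (s ∷ Z) (x ∷ a) ≡ hit i s x + hits i Z a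
    hits-∷ {n} i s Z x a =
      trans (cong (count Z? ∘ filter M?) (allFin-suc n)) (go)
      where
      M? = λ j → lookup (x ∷ a) j Fin.≟ i
      Z? = λ j → lookup (s ∷ Z) j Bool.≟ inside
      rest : count Z? (filter M? (map suc (allFin n))) ≡ hits i Z a
      rest = trans (cong (count Z?) (filter-map M? suc (allFin n))) (count-map Z? suc (machine a i))
      go : count Z? (filter M? (zero ∷ map suc (allFin n))) ≡ hit i s x + hits i Z a
      go with does (x Fin.≟ i)
      ... | false = rest
      ... | true  = trans (count-∷ Z? zero _) (cong (indicator (Bool._≟ inside) s +_) rest)

    hits-full : ∀ {n} i (a : Vec (Fin m) n) → hits i ⊤ a ≡ length (machine a i)
    hits-full {n} i a = full (machine a i)
      where
      full : ∀ (js : List (Fin n)) → count (λ j → lookup ⊤ j Bool.≟ inside) js ≡ length js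
      full [] = refl
      full (j ∷ js) rewrite Vec.lookup-replicate j inside = cong suc (full js)

    -- This is m ^ n times the expectation of 2 ^ hits; the base 2 keeps the exponential moment in
    -- ℕ.
    moment : ∀ {n} → Fin m → Subset n → ℕ
    moment {n} i Z = sum (map (λ a → 2 ^ hits i Z a) (assignments n))

    -- The coordinates of a uniform assignment are independent, so the moment splits off one factor
    -- per point.
    moment-∷ : ∀ {n} i s (Z : Subset n) →
               moment i (s ∷ Z) ≡ sum (map (λ x → 2 ^ hit i s x) (allFin m)) * moment i Z
    moment-∷ {n} i s Z = go (allFin m)
      where
      open ≡-Reasoning
      f : Vec (Fin m) (suc n) → ℕ
      f a = 2 ^ hits i (s ∷ Z) a
      row : ∀ x as → sum (map f (map (Vec._∷_ x) as)) ≡ 2 ^ hit i s x * sum (map (λ a → 2 ^ hits i Z a) as)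
      row x as = begin
        sum (map f (map (Vec._∷_ x) as))                          ≡⟨ cong sum (map-∘ as) ⟨
        sum (map (λ a → f (x ∷ a)) as)                       ≡⟨ cong sum (map-cong (λ a →
          trans (cong (2 ^_) (hits-∷ i s Z x a)) (^-distribˡ-+-* 2 (hit i s x) _)) as) ⟩
        sum (map (λ a → 2 ^ hit i s x * 2 ^ hits i Z a) as)  ≡⟨ sum-scale (2 ^ hit i s x) (λ a → 2 ^ hits i Z a) as ⟩
        2 ^ hit i s x * sum (map (λ a → 2 ^ hits i Z a) as)  ∎
      go : ∀ xs → sum (map f (cartesianProductWith Vec._∷_ xs (assignments n))) ≡
                  sum (map (λ x → 2 ^ hit i s x) xs) * moment i Z
      go [] = refl
      go (x ∷ xs) = begin
        sum (map f (map (Vec._∷_ x) (assignments n) ++ cartesianProductWith Vec._∷_ xs (assignments n)))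
          ≡⟨ cong sum (map-++ f (map (Vec._∷_ x) (assignments n)) _) ⟩
        sum (map f (map (Vec._∷_ x) (assignments n)) ++ map f (cartesianProductWith Vec._∷_ xs (assignments n)))
          ≡⟨ sum-++ (map f (map (Vec._∷_ x) (assignments n))) _ ⟩
        sum (map f (map (Vec._∷_ x) (assignments n))) + sum (map f (cartesianProductWith Vec._∷_ xs (assignments n)))
          ≡⟨ cong₂ _+_ (row x (assignments n)) (go xs) ⟩
        2 ^ hit i s x * moment i Z + sum (map (λ x → 2 ^ hit i s x) xs) * moment i Z
          ≡⟨ *-distribʳ-+ (moment i Z) (2 ^ hit i s x) _ ⟨
        sum (map (λ x → 2 ^ hit i s x) (x ∷ xs)) * moment i Z ∎

  sum-outside : ∀ {m} (i : Fin m) xs → sum (map (λ x → 2 ^ hit i outside x) xs) ≡ length xs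
  sum-outside i [] = refl
  sum-outside i (x ∷ xs) with does (x Fin.≟ i)
  ... | false = cong suc (sum-outside i xs)
  ... | true  = cong suc (sum-outside i xs)

  sum-ones : ∀ {a} {A : Set a} (xs : List A) → sum (map (λ _ → 1) xs) ≡ length xs
  sum-ones [] = refl
  sum-ones (x ∷ xs) = cong suc (sum-ones xs)

  sum-inside : ∀ {m} (i : Fin m) → sum (map (λ x → 2 ^ hit i inside x) (allFin m)) ≡ suc m
  sum-inside {suc m} i =
    trans (cong (λ xs → sum (map g xs)) (allFin-suc m))
          (trans (cong (λ (xs : List ℕ) → g zero + sum xs) (sym (map-∘ (allFin m)))) (go i))
    where
    g = λ x → 2 ^ hit i inside x
    go : ∀ i → 2 ^ hit i inside zero + sum (map (λ x → 2 ^ hit i inside (suc x)) (allFin m)) ≡ suc (suc m)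
    go zero    = cong (λ k → suc (suc k)) (trans (sum-ones (allFin m)) (length-allFin m))
    go (suc i) = cong suc (sum-inside i)

  -- With denominators cleared, a point of `Z` contributes the factor (m + 1) / m to the expectation
  -- and any other point the factor 1. A bound `q` stands in for the size of `Z` so that
  -- `tail-bound` can choose q = h u.
  moment-bound : ∀ {m n} (i : Fin m) (Z : Subset n) q → ∣ Z ∣ ≤ q →
                 moment i Z * m ^ q ≤ suc m ^ q * m ^ n
  moment-bound {m} i [] q _ =
    subst₂ _≤_ (sym (*-identityˡ (m ^ q))) (sym (*-identityʳ (suc m ^ q))) (^-monoˡ-≤ q (n≤1+n m))
  moment-bound {m} {suc n} i (outside ∷ Z) q ∣Z∣≤q = begin
    moment i (outside ∷ Z) * m ^ q   ≡⟨ cong (_* m ^ q) (trans (moment-∷ i outside Z)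
      (cong (_* moment i Z) (trans (sum-outside i (allFin m)) (length-allFin m)))) ⟩
    m * moment i Z * m ^ q           ≡⟨ *-assoc m _ _ ⟩
    m * (moment i Z * m ^ q)         ≤⟨ *-monoʳ-≤ m (moment-bound i Z q ∣Z∣≤q) ⟩
    m * (suc m ^ q * m ^ n)          ≡⟨ swap m (suc m ^ q) (m ^ n) ⟩
    suc m ^ q * (m * m ^ n)          ∎
    where
    open ≤-Reasoning
    swap : ∀ a b c → a * (b * c) ≡ b * (a * c)
    swap = solve-∀
  moment-bound {m} {suc n} i (inside ∷ Z) (suc q) (s≤s ∣Z∣≤q) = begin
    moment i (inside ∷ Z) * (m * m ^ q)   ≡⟨ cong (_* (m * m ^ q)) (trans (moment-∷ i inside Z)
      (cong (_* moment i Z) (sum-inside i))) ⟩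
    suc m * moment i Z * (m * m ^ q)      ≡⟨ swap (suc m) (moment i Z) m (m ^ q) ⟩
    suc m * m * (moment i Z * m ^ q)      ≤⟨ *-monoʳ-≤ (suc m * m) (moment-bound i Z q ∣Z∣≤q) ⟩
    suc m * m * (suc m ^ q * m ^ n)       ≡⟨ swap (suc m) m (suc m ^ q) (m ^ n) ⟩
    suc m * suc m ^ q * (m * m ^ n)       ∎
    where
    open ≤-Reasoning
    swap : ∀ a b c d → a * b * (c * d) ≡ a * c * (b * d)
    swap = solve-∀

  -- Bernoulli's inequality for (1 - 1/(m+1)) ^ h, multiplied by (m+1) ^ (h+1).
  bernoulli : ∀ m h → suc m ^ suc h ≤ m ^ h * suc m + h * suc m ^ h
  bernoulli m zero = ≤-reflexive (base m)
    where
    base : ∀ m → (1 + m) * 1 ≡ 1 * (1 + m) + 0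
    base = solve-∀
  bernoulli m (suc h) = begin
    suc m * suc m ^ suc h                                  ≤⟨ *-monoʳ-≤ (suc m) (bernoulli m h) ⟩
    suc m * (m ^ h * suc m + h * suc m ^ h)                ≡⟨ expand m (m ^ h) h (suc m ^ h) ⟩
    m * m ^ h * suc m + (suc m * m ^ h + h * (suc m * suc m ^ h))
      ≤⟨ +-monoʳ-≤ (m * m ^ h * suc m) (+-monoˡ-≤ _ (*-monoʳ-≤ (suc m) (^-monoˡ-≤ h (n≤1+n m)))) ⟩
    m * m ^ h * suc m + (suc h * (suc m * suc m ^ h))      ∎
    where
    open ≤-Reasoning
    expand : ∀ m x h y → (1 + m) * (x * (1 + m) + h * y) ≡ m * x * (1 + m) + ((1 + m) * x + h * ((1 + m) * y))
    expand = solve-∀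

  -- The reciprocal of (1 + 1/m) ^ h is (1 - 1/(m+1)) ^ h, which by `bernoulli` is at least 1 -
  -- h/(m+1) ≥ 1/2.
  doubling-power : ∀ m h → 2 * h ≤ suc m → suc m ^ h ≤ 2 * m ^ h
  doubling-power m h 2h≤1+m = *-cancelˡ-≤ (suc m) (+-cancelʳ-≤ (suc m * y) _ _ (begin
    suc m * y + suc m * y               ≡⟨ dup (suc m) y ⟩
    2 * (suc m * y)                     ≤⟨ *-monoʳ-≤ 2 (bernoulli m h) ⟩
    2 * (m ^ h * suc m + h * y)         ≡⟨ expand (m ^ h) m h y ⟩
    suc m * (2 * m ^ h) + 2 * h * y     ≤⟨ +-monoʳ-≤ (suc m * (2 * m ^ h)) (*-monoˡ-≤ y 2h≤1+m) ⟩
    suc m * (2 * m ^ h) + suc m * y     ∎))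
    where
    open ≤-Reasoning
    y = suc m ^ h
    dup : ∀ a b → a * b + a * b ≡ 2 * (a * b)
    dup = solve-∀
    expand : ∀ x m h y → 2 * (x * (1 + m) + h * y) ≡ (1 + m) * (2 * x) + 2 * h * y
    expand = solve-∀

  ^-distribʳ-* : ∀ a b n → (a * b) ^ n ≡ a ^ n * b ^ n
  ^-distribʳ-* a b zero    = refl
  ^-distribʳ-* a b (suc n) = trans (cong (a * b *_) (^-distribʳ-* a b n)) (*-interchange a b (a ^ n) (b ^ n))
    where
    *-interchange : ∀ a b c d → a * b * (c * d) ≡ a * c * (b * d)
    *-interchange = solve-∀

  -- The Chernoff bound, from E[2 ^ hits] ≤ (1 + 1/m) ^ (h u) ≤ 2 ^ u.
  tail-bound : ∀ {m n} .{{_ : NonZero m}} (i : Fin m) (Z : Subset n) h u s t →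
               2 * h ≤ suc m → ∣ Z ∣ ≤ h * u → u + s ≤ t →
               2 ^ s * count (λ a → ¬? (hits i Z a ≤? t)) (assignments {m} n) ≤ m ^ n
  tail-bound {m} {n} i Z h u s t 2h≤1+m ∣Z∣≤hu u+s≤t =
    *-cancelˡ-≤ (2 ^ u) ⦃ m^n≢0 2 u ⦄ (*-cancelʳ-≤ _ _ (m ^ (h * u)) ⦃ m^n≢0 m (h * u) ⦄ (begin
      2 ^ u * (2 ^ s * c) * m ^ (h * u)       ≡⟨ cong (_* m ^ (h * u)) (trans (sym (*-assoc (2 ^ u) _ _))
                                                   (cong (_* c) (sym (^-distribˡ-+-* 2 u s)))) ⟩
      2 ^ (u + s) * c * m ^ (h * u)           ≤⟨ *-monoˡ-≤ (m ^ (h * u))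
        (markov (λ a → ¬? (hits i Z a ≤? t)) _ _ large (assignments n)) ⟩
      moment i Z * m ^ (h * u)                ≤⟨ moment-bound i Z (h * u) ∣Z∣≤hu ⟩
      suc m ^ (h * u) * m ^ n                 ≤⟨ *-monoˡ-≤ (m ^ n) power ⟩
      2 ^ u * m ^ (h * u) * m ^ n             ≡⟨ swap (2 ^ u) _ (m ^ n) ⟩
      2 ^ u * m ^ n * m ^ (h * u)             ∎))
    where
    open ≤-Reasoning
    c = count (λ a → ¬? (hits i Z a ≤? t)) (assignments {m} n)
    swap : ∀ a b c → a * b * c ≡ a * c * b
    swap = solve-∀
    large : ∀ a → ¬ (hits i Z a ≤ t) → 2 ^ (u + s) ≤ 2 ^ hits i Z a
    large a ≰ = ^-monoʳ-≤ 2 (≤-trans u+s≤t (<⇒≤ (≰⇒> ≰)))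
    power : suc m ^ (h * u) ≤ 2 ^ u * m ^ (h * u)
    power = begin
      suc m ^ (h * u)         ≡⟨ ^-*-assoc (suc m) h u ⟨
      (suc m ^ h) ^ u         ≤⟨ ^-monoˡ-≤ u (doubling-power m h 2h≤1+m) ⟩
      (2 * m ^ h) ^ u         ≡⟨ ^-distribʳ-* 2 (m ^ h) u ⟩
      2 ^ u * (m ^ h) ^ u     ≡⟨ cong (2 ^ u *_) (^-*-assoc m h u) ⟩
      2 ^ u * m ^ (h * u)     ∎

  -- Logarithms and numerical estimates.

  n<2^1+⌊log₂n⌋ : ∀ n → n < 2 ^ suc ⌊log₂ n ⌋
  n<2^1+⌊log₂n⌋ n = ≰⇒> λ 2^1+L≤n →
    1+n≰n (≤-trans (≤-reflexive (sym (⌊log₂[2^n]⌋≡n (suc ⌊log₂ n ⌋)))) (⌊log₂⌋-mono-≤ 2^1+L≤n))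

  2*⌊n/2⌋≤n : ∀ n → 2 * ⌊ n /2⌋ ≤ n
  2*⌊n/2⌋≤n zero          = z≤n
  2*⌊n/2⌋≤n (suc zero)    = z≤n
  2*⌊n/2⌋≤n (suc (suc n)) = ≤-trans (≤-reflexive (*-suc 2 ⌊ n /2⌋)) (s≤s (s≤s (2*⌊n/2⌋≤n n)))

  n≤1+2*⌊n/2⌋ : ∀ n → n ≤ suc (2 * ⌊ n /2⌋)
  n≤1+2*⌊n/2⌋ zero          = z≤n
  n≤1+2*⌊n/2⌋ (suc zero)    = ≤-refl
  n≤1+2*⌊n/2⌋ (suc (suc n)) = ≤-trans (s≤s (s≤s (n≤1+2*⌊n/2⌋ n))) (≤-reflexive (cong suc (sym (*-suc 2 ⌊ n /2⌋))))

  2^⌊log₂n⌋≤n : ∀ n → 1 ≤ n → 2 ^ ⌊log₂ n ⌋ ≤ n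
  2^⌊log₂n⌋≤n = <-rec _ step
    where
    step : ∀ n → (∀ {k} → k < n → 1 ≤ k → 2 ^ ⌊log₂ k ⌋ ≤ k) → 1 ≤ n → 2 ^ ⌊log₂ n ⌋ ≤ n
    step 1 rec _ = ≤-refl
    step n@(suc (suc n′)) rec _ = begin
      2 ^ ⌊log₂ n ⌋                  ≤⟨ ^-monoʳ-≤ 2 (m≤n+m∸n ⌊log₂ n ⌋ 1) ⟩
      2 * 2 ^ (⌊log₂ n ⌋ ∸ 1)        ≡⟨ cong (λ e → 2 * 2 ^ e) (⌊log₂⌊n/2⌋⌋≡⌊log₂n⌋∸1 n) ⟨
      2 * 2 ^ ⌊log₂ ⌊ n /2⌋ ⌋        ≤⟨ *-monoʳ-≤ 2 (rec (⌊n/2⌋<n (suc n′)) (s≤s z≤n)) ⟩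
      2 * ⌊ n /2⌋                    ≤⟨ 2*⌊n/2⌋≤n n ⟩
      n                              ∎
      where open ≤-Reasoning

  -- Together with 2 ^ ⌊log₂ n⌋ ≤ n this absorbs squared logarithms into 4 n. Induction needs (L +
  -- 2)² ≤ 2 (L + 1)², which fails for L = 0 and L = 1; hence the three base cases.
  square≤4*2^ : ∀ L → suc L * suc L ≤ 4 * 2 ^ L
  square≤4*2^ 0 = s≤s z≤n
  square≤4*2^ 1 = s≤s (s≤s (s≤s (s≤s z≤n)))
  square≤4*2^ 2 = m≤m+n 9 7
  square≤4*2^ (suc (suc (suc L))) = begin
    (4 + L) * (4 + L)               ≤⟨ m≤m+n _ (2 + 4 * L + L * L) ⟩
    (4 + L) * (4 + L) + (2 + 4 * L + L * L)  ≡⟨ eq L ⟩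
    2 * ((3 + L) * (3 + L))         ≤⟨ *-monoʳ-≤ 2 (square≤4*2^ (suc (suc L))) ⟩
    2 * (4 * 2 ^ (2 + L))           ≡⟨ swap (2 ^ (2 + L)) ⟩
    4 * (2 * 2 ^ (2 + L))           ∎
    where
    open ≤-Reasoning
    eq : ∀ L → (4 + L) * (4 + L) + (2 + 4 * L + L * L) ≡ 2 * ((3 + L) * (3 + L))
    eq = solve-∀
    swap : ∀ x → 2 * (4 * x) ≡ 4 * (2 * x)
    swap = solve-∀

  hit≤ : ∀ {m} (i : Fin m) s x → hit i s x ≤ indicator (Bool._≟ inside) s
  hit≤ i s x with does (x Fin.≟ i)
  ... | false = z≤n
  ... | true  = ≤-refl

  hits≤∣Z∣ : ∀ {m n} (i : Fin m) (Z : Subset n) a → hits i Z a ≤ ∣ Z ∣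
  hits≤∣Z∣ i [] [] = z≤n
  hits≤∣Z∣ i (s ∷ Z) (x ∷ a) =
    ≤-trans (≤-reflexive (hits-∷ i s Z x a))
            (≤-trans (+-mono-≤ (hit≤ i s x) (hits≤∣Z∣ i Z a)) (∣-∣-∷ s))
    where
    ∣-∣-∷ : ∀ s → indicator (Bool._≟ inside) s + ∣ Z ∣ ≤ ∣ s ∷ Z ∣
    ∣-∣-∷ inside  = ≤-refl
    ∣-∣-∷ outside = ≤-refl

  square-sum≤ : ∀ {a b} → a ≤ b → (a + b) * (a + b) ≤ 2 * (a * a) + 2 * (b * b)
  square-sum≤ {a} {b} a≤b with b ∸ a | m+[n∸m]≡n a≤b
  ... | c | refl = ≤-trans (m≤m+n _ (c * c)) (≤-reflexive (eq a c))
    where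
    eq : ∀ a c → (a + (a + c)) * (a + (a + c)) + c * c ≡ 2 * (a * a) + 2 * ((a + c) * (a + c))
    eq = solve-∀

  square-sum : ∀ a b → (a + b) * (a + b) ≤ 2 * (a * a) + 2 * (b * b)
  square-sum a b with ≤-total a b
  ... | inj₁ a≤b = square-sum≤ a≤b
  ... | inj₂ b≤a = subst₂ _≤_ (cong₂ _*_ (+-comm b a) (+-comm b a)) (+-comm (2 * (b * b)) _) (square-sum≤ b≤a)

  -- From n ≤ m² K follows (n / m)² ≤ n K, so a load of order n / m + log n has a square of order n
  -- K. The estimate yields 220, rounded up to 256 = 16².
  load-square : ∀ m n K u l → 1 ≤ m → 1 ≤ n → 1 ≤ K → n ≤ m * m * K →
                m * u ≤ m + 2 * n → l * l ≤ 4 * n →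
                (u + 5 * l) * (u + 5 * l) ≤ 256 * (n * K)
  load-square m n K u l 1≤m 1≤n 1≤K n≤m²K mu≤m+2n l²≤4n = begin
    (u + 5 * l) * (u + 5 * l)                       ≤⟨ square-sum u (5 * l) ⟩
    2 * (u * u) + 2 * (5 * l * (5 * l))             ≡⟨ cong (2 * (u * u) +_) (eq₁ l) ⟩
    2 * (u * u) + 50 * (l * l)                      ≤⟨ +-mono-≤ (*-monoʳ-≤ 2 u²) (*-monoʳ-≤ 50 l²) ⟩
    2 * (10 * (n * K)) + 50 * (4 * (n * K))         ≡⟨ eq₂ (n * K) ⟩
    220 * (n * K)                                   ≤⟨ *-monoˡ-≤ (n * K) (m≤m+n 220 36) ⟩
    256 * (n * K)                                   ∎
    where
    open ≤-Reasoning
    instance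
      nzK : NonZero K
      nzK = >-nonZero 1≤K
      nzm : NonZero m
      nzm = >-nonZero 1≤m
      nzm² : NonZero (m * m)
      nzm² = m*n≢0 m m
    eq₁ : ∀ l → 2 * (5 * l * (5 * l)) ≡ 50 * (l * l)
    eq₁ = solve-∀
    eq₂ : ∀ x → 2 * (10 * x) + 50 * (4 * x) ≡ 220 * x
    eq₂ = solve-∀
    eq₃ : ∀ m x → 2 * (m * m) * x + 8 * (m * m * x) ≡ m * m * (10 * x)
    eq₃ = solve-∀
    eq₄ : ∀ m n → 2 * (m * m) + 2 * (2 * n * (2 * n)) ≡ 2 * (m * m) * 1 + 8 * (n * n)
    eq₄ = solve-∀
    eq₅ : ∀ m x → m * m * (x * x) ≡ m * x * (m * x)
    eq₅ = solve-∀
    eq₆ : ∀ m K n → n * (m * m * K) ≡ m * m * (n * K)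
    eq₆ = solve-∀
    l² : l * l ≤ 4 * (n * K)
    l² = ≤-trans l²≤4n (*-monoʳ-≤ 4 (m≤m*n n K))
    u² : u * u ≤ 10 * (n * K)
    u² = *-cancelˡ-≤ (m * m) (begin
      m * m * (u * u)                               ≡⟨ eq₅ m u ⟩
      m * u * (m * u)                               ≤⟨ *-mono-≤ mu≤m+2n mu≤m+2n ⟩
      (m + 2 * n) * (m + 2 * n)                     ≤⟨ square-sum m (2 * n) ⟩
      2 * (m * m) + 2 * (2 * n * (2 * n))           ≡⟨ eq₄ m n ⟩
      2 * (m * m) * 1 + 8 * (n * n)                 ≤⟨ +-mono-≤ (*-monoʳ-≤ (2 * (m * m)) (*-mono-≤ 1≤n 1≤K))
                                                         (*-monoʳ-≤ 8 (≤-trans (*-monoʳ-≤ n n≤m²K) (≤-reflexive (eq₆ m K n)))) ⟩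
      2 * (m * m) * (n * K) + 8 * (m * m * (n * K)) ≡⟨ eq₃ m (n * K) ⟩
      m * m * (10 * (n * K))                        ∎)

  -- Origin of the slack `5 * l`: there are 2 m bad events whose probabilities must add up to at
  -- most 1 / n², and n² * 2 (n + 1) ≤ n ^ 5 for n ≥ 2.
  union-size : ∀ {m n} l → 2 ≤ n → m ≤ suc n → n ≤ 2 ^ l → n ^ 2 * (m + m) ≤ 2 ^ (5 * l)
  union-size {m} {n} l 2≤n m≤1+n n≤2^l = begin
    n ^ 2 * (m + m)                 ≤⟨ *-monoʳ-≤ (n ^ 2) (+-mono-≤ m≤1+n m≤1+n) ⟩
    n ^ 2 * (suc n + suc n)         ≡⟨ eq₁ n ⟩
    n * n * (2 * n + 2)             ≤⟨ *-monoʳ-≤ (n * n) (+-monoʳ-≤ (2 * n) (≤-trans 2≤n (m≤n*m n 2))) ⟩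
    n * n * (2 * n + 2 * n)         ≡⟨ eq₂ n ⟩
    n * n * (2 * 2 * n)             ≤⟨ *-monoʳ-≤ (n * n) (*-monoˡ-≤ n (*-mono-≤ 2≤n 2≤n)) ⟩
    n * n * (n * n * n)             ≡⟨ eq₃ n ⟩
    n ^ 5                           ≤⟨ ^-monoˡ-≤ 5 n≤2^l ⟩
    (2 ^ l) ^ 5                     ≡⟨ trans (^-*-assoc 2 l 5) (cong (2 ^_) (*-comm l 5)) ⟩
    2 ^ (5 * l)                     ∎
    where
    open ≤-Reasoning
    eq₁ : ∀ n → n * (n * 1) * (1 + n + (1 + n)) ≡ n * n * (2 * n + 2)
    eq₁ = solve-∀
    eq₂ : ∀ n → n * n * (2 * n + 2 * n) ≡ n * n * (2 * 2 * n)
    eq₂ = solve-∀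
    eq₃ : ∀ n → n * n * (n * n * n) ≡ n * (n * (n * (n * (n * 1))))
    eq₃ = solve-∀

  -- Balanced assignments have high probability.

  module Loads (n w : ℕ) where

    m h l : ℕ
    m = suc w
    -- The largest h with 2 h ≤ m + 1, the condition of `doubling-power`.
    h = suc ⌊ w /2⌋
    l = suc ⌊log₂ n ⌋

    2h≤1+m : 2 * h ≤ suc m
    2h≤1+m = ≤-trans (≤-reflexive (*-suc 2 ⌊ w /2⌋)) (s≤s (s≤s (2*⌊n/2⌋≤n w)))

    m≤2h : m ≤ 2 * h
    m≤2h = ≤-trans (s≤s (n≤1+2*⌊n/2⌋ w)) (≤-reflexive (sym (*-suc 2 ⌊ w /2⌋)))

    -- An integer above q / h and at most 1 + 2 q / m; it is the exponent `u` passed to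
    -- `tail-bound`.
    mean : ℕ → ℕ
    mean q = suc (q / h)

    q≤h*mean : ∀ q → q ≤ h * mean q
    q≤h*mean q = begin
      q                   ≡⟨ m≡m%n+[m/n]*n q h ⟩
      q % h + q / h * h   ≤⟨ +-monoˡ-≤ _ (<⇒≤ (m%n<n q h)) ⟩
      h + q / h * h       ≡⟨ *-comm (mean q) h ⟩
      h * mean q          ∎
      where open ≤-Reasoning

    m*mean≤ : ∀ q → m * mean q ≤ m + 2 * q
    m*mean≤ q = begin
      m * suc (q / h)        ≡⟨ *-suc m _ ⟩
      m + m * (q / h)        ≤⟨ +-monoʳ-≤ m (*-monoˡ-≤ (q / h) m≤2h) ⟩
      m + 2 * h * (q / h)    ≡⟨ cong (m +_) (trans (*-assoc 2 h _) (cong (2 *_) (*-comm h (q / h)))) ⟩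
      m + 2 * (q / h * h)    ≤⟨ +-monoʳ-≤ m (*-monoʳ-≤ 2 (m/n*n≤m q h)) ⟩
      m + 2 * q              ∎
      where open ≤-Reasoning

    slack : ℕ → ℕ
    slack q = mean q + 5 * l

    -- A machine cannot hold more than all of the at most z outliers. This cap is what turns log n
    -- into min(log n, z).
    share : ℕ → ℕ
    share z = slack z ⊓ z

    Balanced : ℕ → Subset n → Vec (Fin m) n → Set
    Balanced z Z a = ∀ i → hits i Z a ≤ share z × length (machine a i) ≤ slack n

    -- For z ≤ log n the cap `z` is the better bound. Otherwise m + 5 m (1 + L) is absorbed into 11
    -- m L, where 1 ≤ L because n ≥ 2.
    share-total : ∀ z → 2 ≤ n → m * share z ≤ 2 * z + 11 * (m * (⌊log₂ n ⌋ ⊓ z))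
    share-total z 2≤n with ≤-total z ⌊log₂ n ⌋
    ... | inj₁ z≤L rewrite m≥n⇒m⊓n≡n z≤L = begin
      m * share z                        ≤⟨ *-monoʳ-≤ m (m⊓n≤n (slack z) z) ⟩
      m * z                              ≤⟨ m≤n*m (m * z) 11 ⟩
      11 * (m * z)                       ≤⟨ m≤n+m _ (2 * z) ⟩
      2 * z + 11 * (m * z)               ∎
      where open ≤-Reasoning
    ... | inj₂ L≤z rewrite m≤n⇒m⊓n≡m L≤z = begin
      m * share z                        ≤⟨ *-monoʳ-≤ m (m⊓n≤m (slack z) z) ⟩
      m * (mean z + 5 * l)               ≡⟨ *-distribˡ-+ m (mean z) _ ⟩
      m * mean z + m * (5 * l)           ≤⟨ +-monoˡ-≤ _ (m*mean≤ z) ⟩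
      m + 2 * z + m * (5 * suc L)        ≡⟨ eq₁ m z L ⟩
      2 * z + (6 * m * 1 + 5 * (m * L))  ≤⟨ +-monoʳ-≤ (2 * z) (+-monoˡ-≤ (5 * (m * L)) (*-monoʳ-≤ (6 * m) 1≤L)) ⟩
      2 * z + (6 * m * L + 5 * (m * L))  ≡⟨ eq₂ m z L ⟩
      2 * z + 11 * (m * L)               ∎
      where
      open ≤-Reasoning
      L : ℕ
      L = ⌊log₂ n ⌋
      1≤L : 1 ≤ L
      1≤L = ⌊log₂⌋-mono-≤ 2≤n
      eq₁ : ∀ m z L → m + 2 * z + m * (5 * (1 + L)) ≡ 2 * z + (6 * m * 1 + 5 * (m * L))
      eq₁ = solve-∀
      eq₂ : ∀ m z L → 2 * z + (6 * m * L + 5 * (m * L)) ≡ 2 * z + 11 * (m * L)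
      eq₂ = solve-∀

    slack-square : ∀ K → 1 ≤ n → 1 ≤ K → n < m * m * K → slack n * slack n ≤ 256 * (n * K)
    slack-square K 1≤n 1≤K n<m²K =
      load-square m n K (mean n) l (s≤s z≤n) 1≤n 1≤K (<⇒≤ n<m²K) (m*mean≤ n)
        (≤-trans (square≤4*2^ ⌊log₂ n ⌋) (*-monoʳ-≤ 4 (2^⌊log₂n⌋≤n n 1≤n)))

    balanced : ∀ z (Z : Subset n) → ∣ Z ∣ ≤ z → 2 ≤ n → w ≤ n →
               Σ (List (Vec (Fin m) n)) λ good → Unique good × All (Balanced z Z) good ×
                 n ^ 2 * m ^ n ≤ m ^ n + n ^ 2 * length good
    balanced z Z ∣Z∣≤z 2≤n w≤n =
      filter (all? OK? events) all ,
      Unique.filter⁺ (all? OK? events) (assignments-unique n) ,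
      All.map extract (All.all-filter (all? OK? events) all) ,
      *-cancelˡ-≤ c ⦃ m^n≢0 2 (5 * l) ⦄ (begin
        c * (n ^ 2 * N)                                  ≡⟨ eq₁ c (n ^ 2) N ⟩
        n ^ 2 * (c * N)                                  ≡⟨ cong (λ k → n ^ 2 * (c * k)) (sym (length-assignments n)) ⟩
        n ^ 2 * (c * length all)                         ≤⟨ *-monoʳ-≤ (n ^ 2) (union-bound OK? c N all bad events) ⟩
        n ^ 2 * (c * g + length events * N)              ≡⟨ cong (λ k → n ^ 2 * (c * g + k * N)) length-events ⟩
        n ^ 2 * (c * g + (m + m) * N)                    ≡⟨ eq₂ (n ^ 2) c g (m + m) N ⟩
        n ^ 2 * (m + m) * N + c * (n ^ 2 * g)            ≤⟨ +-monoˡ-≤ _ (*-monoˡ-≤ N (union-size l 2≤n (s≤s w≤n) (<⇒≤ (n<2^1+⌊log₂n⌋ n)))) ⟩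
        c * N + c * (n ^ 2 * g)                          ≡⟨ *-distribˡ-+ c N _ ⟨
        c * (N + n ^ 2 * g)                              ∎)
      where
      open ≤-Reasoning
      c N : ℕ
      c = 2 ^ (5 * l)
      N = m ^ n
      all : List (Vec (Fin m) n)
      all = assignments n
      OK : Fin m ⊎ Fin m → Vec (Fin m) n → Set
      OK (inj₁ i) a = hits i Z a ≤ share z
      OK (inj₂ i) a = hits i ⊤ a ≤ slack n
      OK? : ∀ e a → Dec (OK e a)
      OK? (inj₁ i) a = hits i Z a ≤? share z
      OK? (inj₂ i) a = hits i ⊤ a ≤? slack n
      events : List (Fin m ⊎ Fin m)
      events = map inj₁ (allFin m) ++ map inj₂ (allFin m)
      g : ℕ
      g = count (all? OK? events) all
      length-events : length events ≡ m + m
      length-events = trans (length-++ (map inj₁ (allFin m)))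
        (cong₂ _+_ (trans (length-map inj₁ (allFin m)) (length-allFin m))
                   (trans (length-map inj₂ (allFin m)) (length-allFin m)))
      ∣⊤∣≤ : ∣ ⊤ {n} ∣ ≤ n
      ∣⊤∣≤ = Subset.∣p∣≤n ⊤
      bad : ∀ e → c * count (¬? ∘ OK? e) all ≤ N
      bad (inj₁ i) = ≤-trans
        -- The cap at `z` is never violated, so exceeding `share z` means exceeding `slack z`.
        (*-monoʳ-≤ c (count-mono (¬? ∘ OK? (inj₁ i)) (λ a → ¬? (hits i Z a ≤? slack z))
          (λ a ≰share ≤slack → ≰share (⊓-glb ≤slack (≤-trans (hits≤∣Z∣ i Z a) ∣Z∣≤z))) all))
        (tail-bound i Z h (mean z) (5 * l) (slack z) 2h≤1+m (≤-trans ∣Z∣≤z (q≤h*mean z)) ≤-refl)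
      bad (inj₂ i) = tail-bound i (⊤ {n}) h (mean n) (5 * l) (slack n) 2h≤1+m (≤-trans ∣⊤∣≤ (q≤h*mean n)) ≤-refl
      extract : ∀ {a} → All (λ e → OK e a) events → Balanced z Z a
      extract {a} p i =
        All.lookup (All.map⁻ (All.++⁻ˡ (map inj₁ (allFin m)) p)) (∈-allFin i) ,
        subst (_≤ slack n) (hits-full i a)
          (All.lookup (All.map⁻ (All.++⁻ʳ (map inj₁ (allFin m)) p)) (∈-allFin i))
      eq₁ : ∀ c k N → c * (k * N) ≡ k * (c * N)
      eq₁ = solve-∀
      eq₂ : ∀ k c g e N → k * (c * g + e * N) ≡ k * e * N + c * (k * g)
      eq₂ = solve-∀

open Counting

-- Ordered-field arithmetic, infima, square roots and limits.

module Field {ℓ : Level} (ℝ : CompleteOrderedField ℓ) where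

  open CompleteOrderedField ℝ
  open import Algebra.Properties.Semiring.Mult semiring using (×1-homo-*; ×-homo-+)
  open import Algebra.Solver.Ring.NaturalCoefficients.Default commutativeSemiring
    using (solve; _:=_; _:+_; _:*_; con)
  open import Algebra.Properties.Ring ring using (-‿involutive; -‿distribˡ-*; -‿distribʳ-*)
  open import Relation.Binary.Reasoning.PartialOrder (DecTotalOrder.poset decTotalOrder)

  ≰⇒≥ : ∀ {x y} → ¬ (x ≤ y) → y ≤ x
  ≰⇒≥ {x} {y} x≰y with total x y
  ... | inj₁ x≤y = contradiction x≤y x≰y
  ... | inj₂ y≤x = y≤x

  ≰⇒> : ∀ {x y} → ¬ (x ≤ y) → y < x
  ≰⇒> x≰y = ≰⇒≥ x≰y , λ y≈x → x≰y (≤-reflexive (sym y≈x))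

  <⇒≱ : ∀ {x y} → x < y → ¬ (y ≤ x)
  <⇒≱ (x≤y , x≉y) y≤x = x≉y (antisym x≤y y≤x)

  ≤-stable : ∀ {x y} → ¬ ¬ (x ≤ y) → x ≤ y
  ≤-stable {x} {y} = decidable-stable (x ≤? y)

  +-mono : ∀ {x y u v} → x ≤ y → u ≤ v → x + u ≤ y + v
  +-mono {x} {y} {u} {v} x≤y u≤v = begin
    x + u  ≤⟨ +-mono-≤ u x≤y ⟩
    y + u  ≈⟨ +-comm y u ⟩
    u + y  ≤⟨ +-mono-≤ y u≤v ⟩
    v + y  ≈⟨ +-comm v y ⟩
    y + v  ∎

  +-cancel : ∀ {x y} z → x + z ≤ y + z → x ≤ y
  +-cancel {x} {y} z h = begin
    x              ≈⟨ lemma x ⟨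
    x + z + - z    ≤⟨ +-mono-≤ (- z) h ⟩
    y + z + - z    ≈⟨ lemma y ⟩
    y              ∎
    where
    lemma : ∀ x → x + z + - z ≈ x
    lemma x = trans (+-assoc x z (- z)) (trans (+-congˡ (-‿inverseʳ z)) (+-identityʳ x))

  x≤y⇒0≤y-x : ∀ {x y} → x ≤ y → 0# ≤ y + - x
  x≤y⇒0≤y-x {x} x≤y = ≤-trans (≤-reflexive (sym (-‿inverseʳ x))) (+-mono-≤ (- x) x≤y)

  sub-add : ∀ x y → y + - x + x ≈ y
  sub-add x y = trans (+-assoc y (- x) x) (trans (+-congˡ (-‿inverseˡ x)) (+-identityʳ y))

  x≤x+y : ∀ {x y} → 0# ≤ y → x ≤ x + y
  x≤x+y {x} {y} 0≤y = begin
    x       ≈⟨ +-identityʳ x ⟨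
    x + 0#  ≤⟨ +-mono ≤-refl 0≤y ⟩
    x + y   ∎

  +-nonNeg : ∀ {x y} → 0# ≤ x → 0# ≤ y → 0# ≤ x + y
  +-nonNeg 0≤x 0≤y = ≤-trans 0≤x (x≤x+y 0≤y)

  *-monoʳ : ∀ {x y} z → 0# ≤ z → x ≤ y → x * z ≤ y * z
  *-monoʳ {x} {y} z 0≤z x≤y = begin
    x * z                  ≤⟨ x≤x+y (*-nonNeg (x≤y⇒0≤y-x x≤y) 0≤z) ⟩
    x * z + (y + - x) * z  ≈⟨ +-comm _ _ ⟩
    (y + - x) * z + x * z  ≈⟨ distribʳ z (y + - x) x ⟨
    (y + - x + x) * z      ≈⟨ *-congʳ (sub-add x y) ⟩
    y * z                  ∎

  *-monoˡ : ∀ {x y} z → 0# ≤ z → x ≤ y → z * x ≤ z * y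
  *-monoˡ {x} {y} z 0≤z x≤y =
    ≤-trans (≤-reflexive (*-comm z x)) (≤-trans (*-monoʳ z 0≤z x≤y) (≤-reflexive (*-comm y z)))

  *-mono : ∀ {x y u v} → 0# ≤ u → 0# ≤ y → x ≤ y → u ≤ v → x * u ≤ y * v
  *-mono 0≤u 0≤y x≤y u≤v = ≤-trans (*-monoʳ _ 0≤u x≤y) (*-monoˡ _ 0≤y u≤v)

  0≤1 : 0# ≤ 1#
  0≤1 with total 0# 1#
  ... | inj₁ p = p
  ... | inj₂ q = ≤-trans (*-nonNeg 0≤-1 0≤-1) (≤-reflexive eq)
    where
    0≤-1 : 0# ≤ - 1#
    0≤-1 = ≤-trans (x≤y⇒0≤y-x q) (≤-reflexive (+-identityˡ (- 1#)))
    eq : - 1# * - 1# ≈ 1#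
    eq = trans (sym (-‿distribˡ-* 1# (- 1#))) (trans (-‿cong (*-identityˡ (- 1#))) (-‿involutive 1#))

  1≰0 : ¬ (1# ≤ 0#)
  1≰0 1≤0 = 0≉1 (antisym 0≤1 1≤0)

  module _ {x : Carrier} (0<x : 0# < x) where

    private
      x≉0 : ¬ (x ≈ 0#)
      x≉0 = proj₂ 0<x ∘ sym

    ⁻¹-nonNeg : 0# ≤ x ⁻¹
    ⁻¹-nonNeg with total 0# (x ⁻¹)
    ... | inj₁ p = p
    ... | inj₂ q = contradiction (begin
      1#         ≈⟨ inverse x x≉0 ⟨
      x * x ⁻¹   ≤⟨ *-monoˡ x (proj₁ 0<x) q ⟩
      x * 0#     ≈⟨ zeroʳ x ⟩
      0#         ∎) 1≰0

    *-inverse-cancel : ∀ y → y * x * x ⁻¹ ≈ y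
    *-inverse-cancel y = trans (*-assoc y x (x ⁻¹)) (trans (*-congˡ (inverse x x≉0)) (*-identityʳ y))

    ≤*⇒*⁻¹≤ : ∀ {y z} → y ≤ z * x → y * x ⁻¹ ≤ z
    ≤*⇒*⁻¹≤ {y} {z} h = ≤-trans (*-monoʳ (x ⁻¹) ⁻¹-nonNeg h) (≤-reflexive (*-inverse-cancel z))

    *≤⇒≤*⁻¹ : ∀ {y z} → y * x ≤ z → y ≤ z * x ⁻¹
    *≤⇒≤*⁻¹ {y} {z} h = ≤-trans (≤-reflexive (sym (*-inverse-cancel y))) (*-monoʳ (x ⁻¹) ⁻¹-nonNeg h)

    *-cancel : ∀ {y z} → y * x ≤ z * x → y ≤ z
    *-cancel h = ≤-trans (*≤⇒≤*⁻¹ h) (≤-reflexive (*-inverse-cancel _))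

  *-pos : ∀ {x y} → 0# < x → 0# < y → 0# < x * y
  *-pos {x} {y} 0<x 0<y = *-nonNeg (proj₁ 0<x) (proj₁ 0<y) , λ 0≈xy →
    <⇒≱ 0<x (*-cancel 0<y (≤-reflexive (trans (sym 0≈xy) (sym (zeroˡ y)))))

  fromℕ-+ : ∀ m n → fromℕ (m ℕ.+ n) ≈ fromℕ m + fromℕ n
  fromℕ-+ = ×-homo-+ 1#

  fromℕ-* : ∀ m n → fromℕ (m ℕ.* n) ≈ fromℕ m * fromℕ n
  fromℕ-* = ×1-homo-*

  fromℕ-^ : ∀ m n → fromℕ (m ℕ.^ n) ≈ fromℕ m ^ n
  fromℕ-^ m zero    = +-identityʳ 1#
  fromℕ-^ m (suc n) = trans (fromℕ-* m (m ℕ.^ n)) (*-congˡ (fromℕ-^ m n))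

  fromℕ-nonNeg : ∀ n → 0# ≤ fromℕ n
  fromℕ-nonNeg zero    = ≤-refl
  fromℕ-nonNeg (suc n) = +-nonNeg 0≤1 (fromℕ-nonNeg n)

  fromℕ-mono : ∀ {m n} → m ℕ.≤ n → fromℕ m ≤ fromℕ n
  fromℕ-mono {n = n} ℕ.z≤n = fromℕ-nonNeg n
  fromℕ-mono (ℕ.s≤s m≤n)   = +-mono ≤-refl (fromℕ-mono m≤n)

  fromℕ-1 : fromℕ 1 ≈ 1#
  fromℕ-1 = +-identityʳ 1#

  fromℕ-pos : ∀ {n} → 1 ℕ.≤ n → 0# < fromℕ n
  fromℕ-pos {n} 1≤n = fromℕ-nonNeg n , λ 0≈n →
    1≰0 (≤-trans (≤-reflexive (sym fromℕ-1)) (≤-trans (fromℕ-mono 1≤n) (≤-reflexive (sym 0≈n))))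

  1≤⇒0<  : ∀ {x} → 1# ≤ x → 0# < x
  1≤⇒0< 1≤x = ≤-trans 0≤1 1≤x , λ 0≈x → 1≰0 (≤-trans 1≤x (≤-reflexive (sym 0≈x)))

  ^-nonNeg : ∀ {x} n → 0# ≤ x → 0# ≤ x ^ n
  ^-nonNeg zero    0≤x = 0≤1
  ^-nonNeg (suc n) 0≤x = *-nonNeg 0≤x (^-nonNeg n 0≤x)

  ^-pos : ∀ {x} n → 0# < x → 0# < x ^ n
  ^-pos zero    0<x = 0≤1 , 0≉1
  ^-pos (suc n) 0<x = *-pos 0<x (^-pos n 0<x)

  ^-mono : ∀ {x y} n → 0# ≤ x → x ≤ y → x ^ n ≤ y ^ n
  ^-mono zero    0≤x x≤y = ≤-refl
  ^-mono (suc n) 0≤x x≤y = *-mono (^-nonNeg n 0≤x) (≤-trans 0≤x x≤y) x≤y (^-mono n 0≤x x≤y)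

  1≤⇒1≤^ : ∀ {x} n → 1# ≤ x → 1# ≤ x ^ n
  1≤⇒1≤^ zero    1≤x = ≤-refl
  1≤⇒1≤^ (suc n) 1≤x = ≤-trans (≤-reflexive (sym (*-identityˡ 1#)))
    (*-mono 0≤1 (≤-trans 0≤1 1≤x) 1≤x (1≤⇒1≤^ n 1≤x))

  1≤2 : 1# ≤ 1# + 1#
  1≤2 = x≤x+y 0≤1

  half+half : ∀ x → half x + half x ≈ x
  half+half x = trans (lemma x ((1# + 1#) ⁻¹)) (*-inverse-cancel (1≤⇒0< 1≤2) x)
    where
    lemma : ∀ x y → x * y + x * y ≈ x * (1# + 1#) * y
    lemma = solve 2 (λ x y → x :* y :+ x :* y := x :* (con 1 :+ con 1) :* y) refl

  half-nonNeg : ∀ {x} → 0# ≤ x → 0# ≤ half x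
  half-nonNeg 0≤x = *-nonNeg 0≤x (⁻¹-nonNeg (1≤⇒0< 1≤2))

  -- Weak excluded middle: the supremum of {0} ∪ {1 | Q} is compared with 1/2.
  weak-excluded-middle : (Q : Set ℓ) → ¬ Q ⊎ ¬ ¬ Q
  weak-excluded-middle Q with complete S (0# , inj₁ refl) (1# , bounded)
    where
    S : Pred Carrier ℓ
    S x = x ≈ 0# ⊎ (x ≈ 1# × Q)
    bounded : IsUpperBound S 1#
    bounded x (inj₁ x≈0)       = ≤-trans (≤-reflexive x≈0) 0≤1
    bounded x (inj₂ (x≈1 , _)) = ≤-reflexive x≈1
  ... | s , upper , least with 1# ≤? s
  ...   | no  1≰s = inj₁ λ q → 1≰s (upper 1# (inj₂ (refl , q)))
  ...   | yes 1≤s = inj₂ λ ¬q → 1≰0 (≤-trans 1≤s (least 0# λ where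
            x (inj₁ x≈0)     → ≤-reflexive x≈0
            x (inj₂ (_ , q)) → contradiction q ¬q))

  infimum : (S : Pred Carrier ℓ) → ∃ S → ∃ (IsLowerBound S) → ∃ (IsInfimum S)
  infimum S (x , Sx) (b , lower) with complete (IsLowerBound S) (b , lower) (x , λ l Sl → Sl x Sx)
  ... | s , upper , least = s , (λ y Sy → least y (λ l Sl → Sl y Sy)) , upper

  ≤√ : ∀ {t x} → t * t ≤ x → t ≤ √ x
  ≤√ {t} {x} tt≤x = proj₁ (√-isSupremum x) t (inj₂ tt≤x)

  √-nonNeg : ∀ x → 0# ≤ √ x
  √-nonNeg x = proj₁ (√-isSupremum x) 0# (inj₁ ≤-refl)

  -- `√` is given as a supremum, so it is enough to place t / c in the set that defines it; no
  -- identity for the square of a root enters.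
  ≤*√ : ∀ {t c x} → 0# < c → t * t ≤ c * c * x → t ≤ c * √ x
  ≤*√ {t} {c} {x} 0<c tt≤ccx = begin
    t                 ≈⟨ *-inverse-cancel 0<c t ⟨
    t * c * c ⁻¹      ≈⟨ trans (*-congʳ (*-comm t c)) (*-assoc c t (c ⁻¹)) ⟩
    c * (t * c ⁻¹)    ≤⟨ *-monoˡ c (proj₁ 0<c) (≤√ square) ⟩
    c * √ x           ∎
    where
    square : t * c ⁻¹ * (t * c ⁻¹) ≤ x
    square = *-cancel (*-pos 0<c 0<c) (begin
      t * c ⁻¹ * (t * c ⁻¹) * (c * c)   ≈⟨ lemma t c (c ⁻¹) ⟩
      t * t * c * c ⁻¹ * c * c ⁻¹       ≈⟨ trans (*-congʳ (*-congʳ (*-inverse-cancel 0<c (t * t)))) (*-inverse-cancel 0<c (t * t)) ⟩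
      t * t                             ≤⟨ tt≤ccx ⟩
      c * c * x                         ≈⟨ *-comm (c * c) x ⟩
      x * (c * c)                       ∎)
      where
      lemma : ∀ t c d → t * d * (t * d) * (c * c) ≈ t * t * c * d * c * d
      lemma = solve 3 (λ t c d → t :* d :* (t :* d) :* (c :* c) := t :* t :* c :* d :* c :* d) refl

  -- Only the double negation is available: a witness cannot be extracted from a supremum.
  archimedean : ∀ {x} → 0# < x → ∀ y → ¬ ¬ ∃ λ j → y ≤ x * fromℕ (2 ℕ.^ j)
  archimedean {x} 0<x y none with complete S (x * fromℕ 1 , 0 , refl) (y , bounded)
    where
    S : Pred Carrier ℓ
    S t = ∃ λ j → t ≈ x * fromℕ (2 ℕ.^ j)
    bounded : IsUpperBound S y
    bounded t (j , t≈) = ≤-trans (≤-reflexive t≈) (≰⇒≥ λ y≤ → none (j , y≤))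
  ... | s , upper , least = <⇒≱ 0<x (begin
    x              ≈⟨ trans (*-congˡ fromℕ-1) (*-identityʳ x) ⟨
    x * fromℕ 1    ≤⟨ upper _ (0 , refl) ⟩
    s              ≤⟨ s≤½ ⟩
    half s         ≤⟨ +-cancel (half s) ½+½≤½ ⟩
    0#             ∎)
    where
    double : ∀ x j → x * fromℕ (2 ℕ.^ suc j) ≈ x * fromℕ (2 ℕ.^ j) * (1# + 1#)
    double x j = trans (*-congˡ (trans (fromℕ-* 2 (2 ℕ.^ j)) (*-congʳ (+-congˡ fromℕ-1))))
      (lemma x (fromℕ (2 ℕ.^ j)))
      where
      lemma : ∀ x y → x * ((1# + 1#) * y) ≈ x * y * (1# + 1#)
      lemma = solve 2 (λ x y → x :* ((con 1 :+ con 1) :* y) := x :* y :* (con 1 :+ con 1)) refl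
    -- The double of every element of `S` is again in `S`, so s / 2 is already an upper bound.
    s≤½ : s ≤ half s
    s≤½ = least (half s) λ where
      t (j , t≈) → ≤-trans (≤-reflexive t≈) (*≤⇒≤*⁻¹ (1≤⇒0< 1≤2)
        (≤-trans (≤-reflexive (sym (double x j))) (upper _ (suc j , refl))))
    ½+½≤½ : half s + half s ≤ 0# + half s
    ½+½≤½ = ≤-trans (≤-reflexive (half+half s)) (≤-trans s≤½ (≤-reflexive (sym (+-identityˡ (half s)))))

  x<x+1 : ∀ x → x < x + 1#
  x<x+1 x = ≰⇒> λ h → 1≰0 (+-cancel x
    (≤-trans (≤-reflexive (+-comm 1# x)) (≤-trans h (≤-reflexive (sym (+-identityˡ x))))))

  -- If y exceeded x, their midpoint would lie above x but below y. This transfers bounds to the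
  -- optimum, since covers are available only at radii strictly above it.
  ≤-limit : ∀ {x y} → (∀ r → x < r → y ≤ r) → y ≤ x
  ≤-limit {x} {y} bound = ≤-stable λ y≰x → y≰x (+-cancel y (begin
    y + y         ≤⟨ +-mono (bound mid (x<mid y≰x)) (bound mid (x<mid y≰x)) ⟩
    mid + mid     ≈⟨ half+half (x + y) ⟩
    x + y         ∎))
    where
    mid : Carrier
    mid = half (x + y)
    x<mid : ¬ (y ≤ x) → x < mid
    x<mid y≰x = ≰⇒> λ mid≤x → y≰x (+-cancel x (begin
      y + x         ≈⟨ +-comm y x ⟩
      x + y         ≈⟨ half+half (x + y) ⟨
      mid + mid     ≤⟨ +-mono mid≤x mid≤x ⟩
      x + x         ∎))

  -- A downward search from a known exponent. It stops where the predecessor fails, and that failure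
  -- gives the upper bound `y + y`; it cannot run down to exponent 0 because x < y.
  least-exponent : ∀ {x y : Carrier} → x < y → ∀ j → y ≤ x * fromℕ (2 ℕ.^ j) →
                   ∃ λ i → y ≤ x * fromℕ (2 ℕ.^ i) × x * fromℕ (2 ℕ.^ i) ≤ y + y
  least-exponent {x} {y} x<y zero y≤ =
    contradiction (≤-trans y≤ (≤-reflexive (trans (*-congˡ fromℕ-1) (*-identityʳ x)))) (<⇒≱ x<y)
  least-exponent {x} {y} x<y (suc j) y≤ with y ≤? x * fromℕ (2 ℕ.^ j)
  ... | yes p = least-exponent x<y j p
  ... | no  p = suc j , y≤ , (begin
    x * fromℕ (2 ℕ.* 2 ℕ.^ j)                              ≈⟨ *-congˡ (fromℕ-* 2 (2 ℕ.^ j)) ⟩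
    x * (fromℕ 2 * fromℕ (2 ℕ.^ j))                        ≈⟨ *-congˡ (*-congʳ (+-congˡ fromℕ-1)) ⟩
    x * ((1# + 1#) * fromℕ (2 ℕ.^ j))                      ≈⟨ lemma x (fromℕ (2 ℕ.^ j)) ⟩
    x * fromℕ (2 ℕ.^ j) + x * fromℕ (2 ℕ.^ j)              ≤⟨ +-mono (≰⇒≥ p) (≰⇒≥ p) ⟩
    y + y                                                  ∎)
    where
    lemma : ∀ x y → x * ((1# + 1#) * y) ≈ x * y + x * y
    lemma = solve 2 (λ x y → x :* ((con 1 :+ con 1) :* y) := x :* y :+ x :* y) refl

-- The integer K in place of k / ε ^ d, and the passage to √.

module Scale {ℓ : Level} (ℝ : CompleteOrderedField ℓ) (d n k : ℕ) (1≤k : 1 ℕ.≤ k)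
             (ε : CompleteOrderedField.Carrier ℝ)
             (0<ε : CompleteOrderedField._<_ ℝ (CompleteOrderedField.0# ℝ) ε)
             (ε≤1 : CompleteOrderedField._≤_ ℝ ε (CompleteOrderedField.1# ℝ)) where

  open CompleteOrderedField ℝ
  open Field ℝ
  open import Algebra.Properties.CommutativeSemiring.Exp commutativeSemiring using (^-distrib-*; ^-congˡ)
  open import Algebra.Solver.Ring.NaturalCoefficients.Default commutativeSemiring
    using (solve; _:=_; _:*_)
  open import Relation.Binary.Reasoning.PartialOrder (DecTotalOrder.poset decTotalOrder)

  -- How many balls of radius r / 2 ^ j replace k balls of radius r when the doubling property is
  -- applied j times.
  balls : ℕ → ℕ
  balls j = k ℕ.* (2 ℕ.^ j) ℕ.^ d

  private
    0≤ε^d : 0# ≤ ε ^ d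
    0≤ε^d = ^-nonNeg d (proj₁ 0<ε)

    balls*ε^d : ∀ j → fromℕ (balls j) * ε ^ d ≈ fromℕ k * (ε * fromℕ (2 ℕ.^ j)) ^ d
    balls*ε^d j = begin-equality
      fromℕ (balls j) * ε ^ d                      ≈⟨ *-congʳ (trans (fromℕ-* k _) (*-congˡ (fromℕ-^ (2 ℕ.^ j) d))) ⟩
      fromℕ k * fromℕ (2 ℕ.^ j) ^ d * ε ^ d        ≈⟨ trans (*-assoc _ _ _) (*-congˡ (*-comm _ _)) ⟩
      fromℕ k * (ε ^ d * fromℕ (2 ℕ.^ j) ^ d)      ≈⟨ *-congˡ (^-distrib-* ε (fromℕ (2 ℕ.^ j)) d) ⟨
      fromℕ k * (ε * fromℕ (2 ℕ.^ j)) ^ d          ∎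

  2# : Carrier
  2# = 1# + 1#

  -- The lower bound makes 2 r / 2 ^ j, which bounds the diameter of a small ball, at most ε r; the
  -- upper bound keeps the number of balls within 4 ^ d k / ε ^ d.
  Fits : ℕ → ℕ → Set ℓ
  Fits K j = 2# ≤ ε * fromℕ (2 ℕ.^ j) × ε * fromℕ (2 ℕ.^ j) ≤ 2# + 2# × balls j ≡ K

  private
    ε<2 : ε < 2#
    ε<2 = ≤-trans ε≤1 1≤2 , λ ε≈2 → 1≰0 (+-cancel 1# (begin
      1# + 1#    ≈⟨ ε≈2 ⟨
      ε          ≤⟨ ε≤1 ⟩
      1#         ≈⟨ +-identityˡ 1# ⟨
      0# + 1#    ∎))

    fits-exists : ¬ ¬ ∃ λ K → ∃ (Fits K)
    fits-exists none = archimedean 0<ε 2# λ where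
      (j , 2≤) → let i , lower , upper = least-exponent ε<2 j 2≤ in
        none (balls i , i , lower , upper , ≡.refl)

    fits-lower : ∀ {K j} → Fits K j → fromℕ k ≤ fromℕ K * ε ^ d
    fits-lower {K} {j} (2≤ , _ , ≡.refl) = begin
      fromℕ k                                   ≈⟨ *-identityʳ (fromℕ k) ⟨
      fromℕ k * 1#                              ≤⟨ *-monoˡ (fromℕ k) (fromℕ-nonNeg k) (1≤⇒1≤^ d (≤-trans 1≤2 2≤)) ⟩
      fromℕ k * (ε * fromℕ (2 ℕ.^ j)) ^ d       ≈⟨ balls*ε^d j ⟨
      fromℕ (balls j) * ε ^ d                   ∎

    fits-upper : ∀ {K j} → Fits K j → fromℕ K * ε ^ d ≤ fromℕ (4 ℕ.^ d ℕ.* k)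
    fits-upper {K} {j} (_ , ≤4 , ≡.refl) = begin
      fromℕ (balls j) * ε ^ d                   ≈⟨ balls*ε^d j ⟩
      fromℕ k * (ε * fromℕ (2 ℕ.^ j)) ^ d       ≤⟨ *-monoˡ (fromℕ k) (fromℕ-nonNeg k)
        (^-mono d (*-nonNeg (proj₁ 0<ε) (fromℕ-nonNeg (2 ℕ.^ j))) (≤-trans ≤4 (≤-reflexive four))) ⟩
      fromℕ k * fromℕ 4 ^ d                     ≈⟨ *-congˡ (fromℕ-^ 4 d) ⟨
      fromℕ k * fromℕ (4 ℕ.^ d)                 ≈⟨ *-comm _ _ ⟩
      fromℕ (4 ℕ.^ d) * fromℕ k                 ≈⟨ fromℕ-* (4 ℕ.^ d) k ⟨
      fromℕ (4 ℕ.^ d ℕ.* k)                     ∎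
      where
      four : 2# + 2# ≈ fromℕ 4
      four = trans (+-assoc 1# 1# 2#) (+-congˡ (+-congˡ (+-congˡ (sym fromℕ-1))))

    1≤balls : ∀ j → 1 ℕ.≤ balls j
    1≤balls j = ℕ.*-mono-≤ 1≤k (ℕ.m^n>0 (2 ℕ.^ j) ⦃ ℕ.m^n≢0 2 j ⦄ d)

    -- The search runs over values of `balls` and not over exponents, because a bound on the value
    -- need not bound the exponent: for d = 0 every exponent gives k. The existential over j stays
    -- unbounded, so each value is tested by weak excluded middle only.
    search : ∀ N → (∃ λ K → ¬ ¬ ∃ (Fits K)) ⊎ (∀ K → K ℕ.≤ N → ¬ ∃ (Fits K))
    search N with weak-excluded-middle (∃ (Fits N))
    search N | inj₂ p = inj₁ (N , p)
    search zero | inj₁ ¬p = inj₂ λ { zero ℕ.z≤n → ¬p }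
    search (suc N) | inj₁ ¬p with search N
    ... | inj₁ q  = inj₁ q
    ... | inj₂ ¬q = inj₂ λ K K≤1+N → below K (ℕ.m≤n⇒m<n∨m≡n K≤1+N)
      where
      below : ∀ K → (K ℕ.< suc N) ⊎ (K ≡ suc N) → ¬ ∃ (Fits K)
      below K (inj₁ (ℕ.s≤s K≤N)) = ¬q K K≤N
      below K (inj₂ ≡.refl)      = ¬p

  -- K plays the role of k / ε ^ d.  Exponents j with 2 ≤ ε 2 ^ j ≤ 4 cannot be found by
  -- an unbounded search, but if none gives a value of at most n, then a single machine suffices.
  record NetSize : Set ℓ where
    field
      K       : ℕ
      1≤K     : 1 ℕ.≤ K
      workers : ∀ w → w ℕ.* w ℕ.* K ℕ.≤ n → fromℕ (w ℕ.* w) * fromℕ k ≤ fromℕ n * ε ^ d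
      upper   : fromℕ K * ε ^ d ≤ fromℕ (4 ℕ.^ d ℕ.* k)
      packing : ¬ ¬ (n ℕ.≤ K ⊎ ∃ λ j → 2# ≤ ε * fromℕ (2 ℕ.^ j) × balls j ℕ.≤ K)

  netSize-exists : NetSize
  netSize-exists with search n
  ... | inj₁ (K , ¬¬fits) = record
    { K       = K
    ; 1≤K     = decidable-stable (1 ℕ.≤? K) λ ¬1≤K → ¬¬fits λ { (j , _ , _ , ≡.refl) → ¬1≤K (1≤balls j) }
    ; workers = λ w w²K≤n → ≤-stable λ ¬goal → ¬¬fits λ { (j , fits) → ¬goal (workers w {j} w²K≤n fits) }
    ; upper   = ≤-stable λ ¬goal → ¬¬fits λ { (j , fits) → ¬goal (fits-upper {K} {j} fits) }
    ; packing = λ none → ¬¬fits λ { (j , 2≤ , _ , ≡.refl) → none (inj₂ (j , 2≤ , ℕ.≤-refl)) }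
    }
    where
    workers : ∀ w {j} → w ℕ.* w ℕ.* K ℕ.≤ n → Fits K j → fromℕ (w ℕ.* w) * fromℕ k ≤ fromℕ n * ε ^ d
    workers w {j} w²K≤n fits = begin
      fromℕ (w ℕ.* w) * fromℕ k               ≤⟨ *-monoˡ _ (fromℕ-nonNeg (w ℕ.* w)) (fits-lower {K} {j} fits) ⟩
      fromℕ (w ℕ.* w) * (fromℕ K * ε ^ d)     ≈⟨ *-assoc _ _ _ ⟨
      fromℕ (w ℕ.* w) * fromℕ K * ε ^ d       ≈⟨ *-congʳ (fromℕ-* (w ℕ.* w) K) ⟨
      fromℕ (w ℕ.* w ℕ.* K) * ε ^ d           ≤⟨ *-monoʳ _ 0≤ε^d (fromℕ-mono w²K≤n) ⟩
      fromℕ n * ε ^ d                         ∎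
  -- Every fitting value exceeds n, so n + 1 is at most such a value and inherits its upper bound.
  -- It also forces w = 0 and makes the packing bound trivial.
  ... | inj₂ none = record
    { K       = suc n
    ; 1≤K     = ℕ.s≤s ℕ.z≤n
    ; workers = workers
    ; upper   = ≤-stable λ ¬goal → fits-exists λ { (K , j , fits) →
        ¬goal (≤-trans (*-monoʳ _ 0≤ε^d (fromℕ-mono (ℕ.≰⇒> λ K≤n → none K K≤n (j , fits)))) (fits-upper {K} {j} fits)) }
    ; packing = λ ¬goal → ¬goal (inj₁ (ℕ.n≤1+n n))
    }
    where
    workers : ∀ w → w ℕ.* w ℕ.* suc n ℕ.≤ n → fromℕ (w ℕ.* w) * fromℕ k ≤ fromℕ n * ε ^ d
    workers zero    _ = ≤-trans (≤-reflexive (zeroˡ (fromℕ k))) (*-nonNeg (fromℕ-nonNeg n) 0≤ε^d)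
    workers (suc w) h = contradiction (ℕ.≤-trans (ℕ.m≤n*m (suc n) (suc w ℕ.* suc w)) h) ℕ.1+n≰n

  module Bounds (N : NetSize) where

    open NetSize N

    S T : Carrier
    S = √ (fromℕ n * ε ^ d * fromℕ k ⁻¹)
    T = √ (fromℕ n * fromℕ k * (ε ^ d) ⁻¹)

    w≤S : ∀ w → w ℕ.* w ℕ.* K ℕ.≤ n → fromℕ w ≤ S
    w≤S w w²K≤n = ≤√ (*≤⇒≤*⁻¹ (fromℕ-pos 1≤k)
      (≤-trans (≤-reflexive (*-congʳ (sym (fromℕ-* w w)))) (workers w w²K≤n)))

    -- 4 ^ d = 2 ^ d * 2 ^ d is absorbed into the constant in front of the square root.
    M≤T : ∀ M a → 1 ℕ.≤ a → M ℕ.* M ℕ.≤ a ℕ.* a ℕ.* (n ℕ.* K) → fromℕ M ≤ fromℕ (a ℕ.* 2 ℕ.^ d) * T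
    M≤T M a 1≤a M²≤ = ≤*√ (fromℕ-pos (ℕ.*-mono-≤ 1≤a (ℕ.m^n>0 2 d))) (begin
      fromℕ M * fromℕ M                                        ≈⟨ fromℕ-* M M ⟨
      fromℕ (M ℕ.* M)                                          ≤⟨ fromℕ-mono M²≤ ⟩
      fromℕ (a ℕ.* a ℕ.* (n ℕ.* K))                            ≈⟨ fromℕ-* (a ℕ.* a) (n ℕ.* K) ⟩
      fromℕ (a ℕ.* a) * fromℕ (n ℕ.* K)                        ≈⟨ *-cong (fromℕ-* a a) (fromℕ-* n K) ⟩
      fromℕ a * fromℕ a * (fromℕ n * fromℕ K)                  ≤⟨ *-monoˡ _ (*-nonNeg 0≤a 0≤a)
                                                                    (*-monoˡ _ (fromℕ-nonNeg n) (*≤⇒≤*⁻¹ (^-pos d 0<ε) upper)) ⟩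
      fromℕ a * fromℕ a * (fromℕ n * (fromℕ (4 ℕ.^ d ℕ.* k) * (ε ^ d) ⁻¹))
        ≈⟨ *-congˡ (*-congˡ (*-congʳ (trans (fromℕ-* (4 ℕ.^ d) k) (*-congʳ four^)))) ⟩
      fromℕ a * fromℕ a * (fromℕ n * (fromℕ (2 ℕ.^ d) * fromℕ (2 ℕ.^ d) * fromℕ k * (ε ^ d) ⁻¹))
        ≈⟨ lemma (fromℕ a) (fromℕ n) (fromℕ (2 ℕ.^ d)) (fromℕ k) ((ε ^ d) ⁻¹) ⟩
      fromℕ a * fromℕ (2 ℕ.^ d) * (fromℕ a * fromℕ (2 ℕ.^ d)) * (fromℕ n * fromℕ k * (ε ^ d) ⁻¹)
        ≈⟨ *-congʳ (*-cong (fromℕ-* a _) (fromℕ-* a _)) ⟨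
      fromℕ (a ℕ.* 2 ℕ.^ d) * fromℕ (a ℕ.* 2 ℕ.^ d) * (fromℕ n * fromℕ k * (ε ^ d) ⁻¹) ∎)
      where
      0≤a : 0# ≤ fromℕ a
      0≤a = fromℕ-nonNeg a
      four^ : fromℕ (4 ℕ.^ d) ≈ fromℕ (2 ℕ.^ d) * fromℕ (2 ℕ.^ d)
      four^ = trans (fromℕ-^ 4 d) (trans (^-congˡ d (fromℕ-* 2 2))
        (trans (^-distrib-* (fromℕ 2) (fromℕ 2) d) (sym (*-cong (fromℕ-^ 2 d) (fromℕ-^ 2 d)))))
      lemma : ∀ a n p k e → a * a * (n * (p * p * k * e)) ≈ a * p * (a * p) * (n * k * e)
      lemma = solve 5 (λ a n p k e → a :* a :* (n :* (p :* p :* k :* e)) := a :* p :* (a :* p) :* (n :* k :* e)) refl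

-- Sublists and weights of weighted lists.

allPairs-lookup : ∀ {r} {R : A → A → Set r} {xs} → AllPairs R xs →
                  ∀ {i j} → i Fin.< j → R (List.lookup xs i) (List.lookup xs j)
allPairs-lookup {xs = x ∷ xs} (x∼xs ∷ _) {zero}  {suc j} _ = All.lookup x∼xs (∈-lookup j)
allPairs-lookup {xs = x ∷ xs} (_ ∷ xs∼) {suc i} {suc j} (ℕ.s≤s i<j) = allPairs-lookup xs∼ i<j

count-sublist : ∀ {P : Pred A p} (P? : Decidable P) {xs ys} → xs ⊑ ys → count P? xs ℕ.≤ count P? ys
count-sublist P? [] = ℕ.z≤n
count-sublist P? (y ∷ʳ xs⊑ys) with does (P? y)
... | false = count-sublist P? xs⊑ys
... | true  = ℕ.m≤n⇒m≤1+n (count-sublist P? xs⊑ys)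
count-sublist P? (_∷_ {x = x} ≡.refl xs⊑ys) with does (P? x)
... | false = count-sublist P? xs⊑ys
... | true  = ℕ.s≤s (count-sublist P? xs⊑ys)

sublist⇒∈ : ∀ {xs ys : List A} → xs ⊑ ys → All (_∈ ys) xs
sublist⇒∈ [] = []
sublist⇒∈ (y ∷ʳ s)     = All.map there (sublist⇒∈ s)
sublist⇒∈ (≡.refl ∷ s) = here ≡.refl ∷ All.map there (sublist⇒∈ s)

weight : {P : Pred A p} → Decidable P → List (A × ℕ) → ℕ
weight P? B = sum (map proj₂ (filter (P? ∘ proj₁) B))

module _ {P : Pred A p} (P? : Decidable P) where

  weight-∷ : ∀ x k B → weight P? ((x , k) ∷ B) ≡ indicator P? x ℕ.* k ℕ.+ weight P? B
  weight-∷ x k B with does (P? x)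
  ... | false = ≡.refl
  ... | true  = ≡.cong (ℕ._+ weight P? B) (≡.sym (ℕ.*-identityˡ k))

  weight-++ : ∀ B C → weight P? (B ++ C) ≡ weight P? B ℕ.+ weight P? C
  weight-++ B C = ≡.trans
    (≡.cong sum (≡.trans (≡.cong (map proj₂) (filter-++ (P? ∘ proj₁) B C)) (map-++ proj₂ (filter (P? ∘ proj₁) B) _)))
    (sum-++ (map proj₂ (filter (P? ∘ proj₁) B)) _)

  weight-units : ∀ xs → weight P? (map (λ x → x , 1) xs) ≡ count P? xs
  weight-units [] = ≡.refl
  weight-units (x ∷ xs) = ≡.trans (weight-∷ x 1 _)
    (≡.trans (≡.cong₂ ℕ._+_ (ℕ.*-identityʳ _) (weight-units xs)) (≡.sym (count-∷ P? x xs)))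

module _ {P : Pred A p} {Q : Pred A q} (P? : Decidable P) (Q? : Decidable Q) where

  indicator-mono : ∀ {x y} → (P x → Q y) → indicator P? x ℕ.≤ indicator Q? y
  indicator-mono {x} {y} h with P? x | Q? y
  ... | no  _  | _      = ℕ.z≤n
  ... | yes _  | yes _  = ℕ.≤-refl
  ... | yes px | no ¬qy = contradiction (h px) ¬qy

-- Greedy nets and the choice of their radius.

module Metric {ℓ : Level} {ℝ : CompleteOrderedField ℓ} (X : MetricSpace ℝ) where

  open CompleteOrderedField ℝ
  open Field ℝ
  open MetricSpace X
  import Relation.Binary.Reasoning.PartialOrder (DecTotalOrder.poset decTotalOrder) as ≤-Reasoning

  private
    module D = IsGeneralMetric isMetric

  0≤dist : ∀ x y → 0# ≤ dist x y
  0≤dist x y = D.nonNegative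

  dist-sym : ∀ x y → dist x y ≈ dist y x
  dist-sym = D.sym

  dist-self : ∀ x → dist x x ≈ 0#
  dist-self x = D.≈⇒0 ≡.refl

  triangle : ∀ x y z → dist x z ≤ dist x y + dist y z
  triangle x y z = D.triangle x y z

  Separated : Carrier → List Point → Set ℓ
  Separated δ = AllPairs (λ x y → δ < dist x y)

  -- The weight of a net point counts the points of Q assigned to it.
  data Bump (δ : Carrier) (y : Point) : WeightedPoints X → WeightedPoints X → Set ℓ where
    here  : ∀ {x k B} → dist x y ≤ δ → Bump δ y ((x , k) ∷ B) ((x , suc k) ∷ B)
    there : ∀ {b B C} → Bump δ y B C → Bump δ y (b ∷ B) (b ∷ C)

  -- The graph of the greedy algorithm as a relation, so that invariants follow by induction on a
  -- run.
  data Net (δ : Carrier) : List Point → WeightedPoints X → Set ℓ where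
    []  : Net δ [] []
    new : ∀ {y Q B} → All (λ b → δ < dist (proj₁ b) y) B → Net δ Q B → Net δ (y ∷ Q) ((y , 1) ∷ B)
    old : ∀ {y Q B C} → Bump δ y B C → Net δ Q B → Net δ (y ∷ Q) C

  bump : ∀ δ y B → ∃ (Bump δ y B) ⊎ All (λ b → δ < dist (proj₁ b) y) B
  bump δ y [] = inj₂ []
  bump δ y ((x , k) ∷ B) with dist x y ≤? δ | bump δ y B
  ... | yes near | _                = inj₁ (_ , here near)
  ... | no  far  | inj₁ (C , later) = inj₁ (_ , there later)
  ... | no  far  | inj₂ fars        = inj₂ (≰⇒> far ∷ fars)

  net : ∀ δ Q → ∃ (Net δ Q)
  net δ [] = [] , []
  net δ (y ∷ Q) with net δ Q
  ... | B , N with bump δ y B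
  ...   | inj₁ (C , b) = C , old b N
  ...   | inj₂ fars    = _ , new fars N

  bump-points : ∀ {δ y B C} → Bump δ y B C → map proj₁ C ≡ map proj₁ B
  bump-points (here _)  = ≡.refl
  bump-points (there b) = ≡.cong (_ ∷_) (bump-points b)

  bumped : ∀ {δ y B C} → Bump δ y B C → ∃ λ x → dist x y ≤ δ
  bumped (here near) = _ , near
  bumped (there b)   = bumped b

  bump-weight : ∀ {p} {P : Pred Point p} (P? : Decidable P) {δ y B C} (b : Bump δ y B C) →
                weight P? C ≡ indicator P? (proj₁ (bumped b)) ℕ.+ weight P? B
  bump-weight P? (here {x} {k} {B} near) = begin-equality
    weight P? ((x , suc k) ∷ B)                              ≡⟨ weight-∷ P? x (suc k) B ⟩
    indicator P? x ℕ.* suc k ℕ.+ weight P? B                 ≡⟨ ≡.cong (ℕ._+ weight P? B) (ℕ.*-suc (indicator P? x) k) ⟩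
    indicator P? x ℕ.+ indicator P? x ℕ.* k ℕ.+ weight P? B  ≡⟨ ℕ.+-assoc (indicator P? x) _ _ ⟩
    indicator P? x ℕ.+ (indicator P? x ℕ.* k ℕ.+ weight P? B) ≡⟨ ≡.cong (indicator P? x ℕ.+_) (weight-∷ P? x k B) ⟨
    indicator P? x ℕ.+ weight P? ((x , k) ∷ B)               ∎
    where open ℕ.≤-Reasoning
  bump-weight P? (there {b = y , k} {B} {C} b) = begin-equality
    weight P? ((y , k) ∷ C)            ≡⟨ weight-∷ P? y k C ⟩
    i ℕ.+ weight P? C                  ≡⟨ ≡.cong (i ℕ.+_) (bump-weight P? b) ⟩
    i ℕ.+ (i′ ℕ.+ weight P? B)         ≡⟨ +-exchange i i′ (weight P? B) ⟩
    i′ ℕ.+ (i ℕ.+ weight P? B)         ≡⟨ ≡.cong (i′ ℕ.+_) (weight-∷ P? y k B) ⟨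
    i′ ℕ.+ weight P? ((y , k) ∷ B)     ∎
    where
    open ℕ.≤-Reasoning
    open import Algebra.Properties.CommutativeSemigroup ℕ.+-commutativeSemigroup using () renaming (x∙yz≈y∙xz to +-exchange)
    i i′ : ℕ
    i = indicator P? y ℕ.* k
    i′ = indicator P? (proj₁ (bumped b))

  net-sublist : ∀ {δ Q B} → Net δ Q B → map proj₁ B ⊑ Q
  net-sublist [] = []
  net-sublist (new _ N) = ≡.refl ∷ net-sublist N
  net-sublist {Q = y ∷ Q} (old b N) = y ∷ʳ ≡.subst (_⊑ Q) (≡.sym (bump-points b)) (net-sublist N)

  net-separated : ∀ {δ Q B} → Net δ Q B → Separated δ (map proj₁ B)
  net-separated [] = []
  net-separated {δ} (new {y} {Q} {B} fars N) =
    All.map⁺ (All.map (λ {b} far → ≰⇒> λ near → <⇒≱ far (≤-trans (≤-reflexive (dist-sym (proj₁ b) y)) near)) fars) ∷ net-separated N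
  net-separated (old b N) = ≡.subst (Separated _) (≡.sym (bump-points b)) (net-separated N)

  net-positive : ∀ {δ Q B} → Net δ Q B → All (λ b → 1 ℕ.≤ proj₂ b) B
  net-positive [] = []
  net-positive (new _ N) = ℕ.≤-refl ∷ net-positive N
  net-positive (old b N) = bump-positive b (net-positive N)
    where
    bump-positive : ∀ {δ y B C} → Bump δ y B C → All (λ b → 1 ℕ.≤ proj₂ b) B → All (λ b → 1 ℕ.≤ proj₂ b) C
    bump-positive (here _)  (_ ∷ pos)  = ℕ.s≤s ℕ.z≤n ∷ pos
    bump-positive (there b) (px ∷ pos) = px ∷ bump-positive b pos

  module _ {p q} {U : Pred Point p} {V : Pred Point q} (U? : Decidable U) (V? : Decidable V)
           {δ} (0≤δ : 0# ≤ δ) where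

    -- Each point of `Q` adds exactly one unit of weight, at a net point within δ of it: itself, at
    -- distance 0 ≤ δ, or the bumped one. The contributions are compared point by point.
    net-weight-≥ : (∀ x y → dist x y ≤ δ → V y → U x) →
                   ∀ {Q B} → Net δ Q B → count V? Q ℕ.≤ weight U? B
    net-weight-≥ h [] = ℕ.z≤n
    net-weight-≥ h {y ∷ Q} (new {B = B} _ N) = ≡.subst₂ ℕ._≤_ (≡.sym (count-∷ V? y Q))
      (≡.sym (≡.trans (weight-∷ U? y 1 B) (≡.cong (ℕ._+ weight U? B) (ℕ.*-identityʳ _))))
      (ℕ.+-mono-≤ (indicator-mono V? U? (h y y (≤-trans (≤-reflexive (dist-self y)) 0≤δ))) (net-weight-≥ h N))
    net-weight-≥ h {y ∷ Q} (old b N) = ≡.subst₂ ℕ._≤_ (≡.sym (count-∷ V? y Q)) (≡.sym (bump-weight U? b))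
      (ℕ.+-mono-≤ (indicator-mono V? U? (h _ y (proj₂ (bumped b)))) (net-weight-≥ h N))

    net-weight-≤ : (∀ x y → dist x y ≤ δ → U x → V y) →
                   ∀ {Q B} → Net δ Q B → weight U? B ℕ.≤ count V? Q
    net-weight-≤ h [] = ℕ.z≤n
    net-weight-≤ h {y ∷ Q} (new {B = B} _ N) = ≡.subst₂ ℕ._≤_
      (≡.sym (≡.trans (weight-∷ U? y 1 B) (≡.cong (ℕ._+ weight U? B) (ℕ.*-identityʳ _))))
      (≡.sym (count-∷ V? y Q))
      (ℕ.+-mono-≤ (indicator-mono U? V? (h y y (≤-trans (≤-reflexive (dist-self y)) 0≤δ))) (net-weight-≤ h N))
    net-weight-≤ h {y ∷ Q} (old b N) = ≡.subst₂ ℕ._≤_ (≡.sym (bump-weight U? b)) (≡.sym (count-∷ V? y Q))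
      (ℕ.+-mono-≤ (indicator-mono U? V? (h _ y (proj₂ (bumped b)))) (net-weight-≤ h N))

  netSize : Carrier → List Point → ℕ
  netSize δ Q = length (proj₁ (net δ Q))

  -- The size of a greedy net is not assumed to be monotone in the radius, so every candidate is
  -- tested. The guarantee is conditional on a candidate with a small net; `0#` is a placeholder if
  -- there is none.
  leastRadius : ∀ B Q D → All (0# ≤_) D → ∃ λ δ → 0# ≤ δ ×
                (∀ {δ′} → δ′ ∈ D → netSize δ′ Q ℕ.≤ B → netSize δ Q ℕ.≤ B × δ ≤ δ′)
  leastRadius B Q [] [] = 0# , ≤-refl , λ ()
  leastRadius B Q (δ₁ ∷ D) (0≤δ₁ ∷ 0≤D) with leastRadius B Q D 0≤D | netSize δ₁ Q ℕ.≤? B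
  ... | δ , 0≤δ , least | no big = δ , 0≤δ , λ where
    (here ≡.refl) small → contradiction small big
    (there δ′∈D)  small → least δ′∈D small
  ... | δ , 0≤δ , least | yes small₁ with netSize δ Q ℕ.≤? B | δ ≤? δ₁
  ...   | yes small | yes δ≤δ₁ = δ , 0≤δ , λ where
    (here ≡.refl) _ → small , δ≤δ₁
    (there δ′∈D)  s → least δ′∈D s
  ...   | yes small | no  δ≰δ₁ = δ₁ , 0≤δ₁ , λ where
    (here ≡.refl) _ → small₁ , ≤-refl
    (there δ′∈D)  s → small₁ , ≤-trans (≰⇒≥ δ≰δ₁) (proj₂ (least δ′∈D s))
  ...   | no big | _ = δ₁ , 0≤δ₁ , λ where
    (here ≡.refl) _ → small₁ , ≤-refl
    (there δ′∈D)  s → contradiction (proj₁ (least δ′∈D s)) big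

  private
    skip : ∀ {x y z : Carrier} {D} → x ∈ y ∷ D → x ∈ y ∷ z ∷ D
    skip (here eq)  = here eq
    skip (there x∈) = there (there x∈)

  greatestBelow : ∀ η D → 0# ≤ η → ∃ λ δ → δ ∈ 0# ∷ D × δ ≤ η × (∀ {x} → x ∈ D → x ≤ η → x ≤ δ)
  greatestBelow η [] 0≤η = 0# , here ≡.refl , 0≤η , λ ()
  greatestBelow η (x ∷ D) 0≤η with greatestBelow η D 0≤η
  ... | δ , δ∈ , δ≤η , greatest with x ≤? η | x ≤? δ
  ...   | yes x≤η | no x≰δ = x , there (here ≡.refl) , x≤η , λ where
    (here ≡.refl) _ → ≤-refl
    (there y∈D) y≤η → ≤-trans (greatest y∈D y≤η) (≰⇒≥ x≰δ)
  ...   | yes _   | yes x≤δ = δ , skip δ∈ , δ≤η , λ where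
    (here ≡.refl) _ → x≤δ
    (there y∈D) y≤η → greatest y∈D y≤η
  ...   | no x≰η  | _ = δ , skip δ∈ , δ≤η , λ where
    (here ≡.refl) x≤η → contradiction x≤η x≰η
    (there y∈D) y≤η → greatest y∈D y≤η

  -- The least radius among 0 and the interpoint distances whose greedy net has at most B points.
  -- No radius has to be guessed: if all η-separated sublists have at most B points,
  -- then the largest such candidate below η already qualifies.
  module Compression (B : ℕ) (Q : List Point) where

    private
      distances : List Carrier
      distances = cartesianProductWith dist Q Q

      0≤distances : All (0# ≤_) (0# ∷ distances)
      0≤distances = ≤-refl ∷ All.tabulate λ x∈ → nonNeg (∈-cartesianProductWith⁻ dist Q Q x∈)
        where
        nonNeg : ∀ {x} → (∃ λ y → ∃ λ z → y ∈ Q × z ∈ Q × x ≡ dist y z) → 0# ≤ x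
        nonNeg (y , z , _ , _ , ≡.refl) = 0≤dist y z

      choice = leastRadius B Q (0# ∷ distances) 0≤distances

    abstract
      radius : Carrier
      radius = proj₁ choice

      0≤radius : 0# ≤ radius
      0≤radius = proj₁ (proj₂ choice)

      compressed : WeightedPoints X
      compressed = proj₁ (net radius Q)

      compressed-net : Net radius Q compressed
      compressed-net = proj₂ (net radius Q)

      compressed-small : ∀ {η} → 0# ≤ η → (∀ {L} → L ⊑ Q → Separated η L → length L ℕ.≤ B) →
                         length compressed ℕ.≤ B × radius ≤ η
      compressed-small {η} 0≤η small with greatestBelow η distances 0≤η
      ... | δ , δ∈ , δ≤η , greatest with net δ Q in eq
      ...   | C , N = let s , r = proj₂ (proj₂ choice) δ∈ (≡.subst (λ P → length (proj₁ P) ℕ.≤ B) (≡.sym eq) C-small) in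
        s , ≤-trans r δ≤η
        where
        sublist : map proj₁ C ⊑ Q
        sublist = net-sublist N
        -- No interpoint distance of `Q` is above δ and at most η, so δ-separated points of `Q` are
        -- already η-separated.
        separated : ∀ {L} → L ⊑ Q → Separated δ L → Separated η L
        separated L⊑Q = go (sublist⇒∈ L⊑Q)
          where
          go : ∀ {L} → All (_∈ Q) L → Separated δ L → Separated η L
          go [] [] = []
          go (x∈ ∷ L∈) (far ∷ sep) = All.tabulate (λ y∈L → ≰⇒> λ near → <⇒≱ (All.lookup far y∈L)
            (greatest (∈-cartesianProductWith⁺ dist x∈ (All.lookup L∈ y∈L)) near)) ∷ go L∈ sep
        C-small : length C ℕ.≤ B
        C-small = ≡.subst (ℕ._≤ B) (length-map proj₁ C) (small sublist (separated sublist (net-separated N)))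

  -- Packing bounds in doubling spaces.

  halves : ℕ → Carrier → Carrier
  halves zero    ρ = ρ
  halves (suc j) ρ = halves j (half ρ)

  double-halves : ∀ j ρ → halves j ρ * fromℕ (2 ℕ.^ j) ≈ ρ
  double-halves zero    ρ = trans (*-congˡ fromℕ-1) (*-identityʳ ρ)
  double-halves (suc j) ρ = begin-equality
    h * fromℕ (2 ℕ.* 2 ℕ.^ j)                   ≈⟨ *-congˡ (reflexive (≡.cong (λ e → fromℕ (2 ℕ.^ j ℕ.+ e)) (ℕ.+-identityʳ (2 ℕ.^ j)))) ⟩
    h * fromℕ (2 ℕ.^ j ℕ.+ 2 ℕ.^ j)             ≈⟨ *-congˡ (fromℕ-+ (2 ℕ.^ j) (2 ℕ.^ j)) ⟩
    h * (fromℕ (2 ℕ.^ j) + fromℕ (2 ℕ.^ j))     ≈⟨ distribˡ h _ _ ⟩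
    h * fromℕ (2 ℕ.^ j) + h * fromℕ (2 ℕ.^ j)   ≈⟨ +-cong (double-halves j (half ρ)) (double-halves j (half ρ)) ⟩
    half ρ + half ρ                             ≈⟨ half+half ρ ⟩
    ρ                                           ∎
    where
    open ≤-Reasoning
    h = halves j (half ρ)

  halves-nonNeg : ∀ j {ρ} → 0# ≤ ρ → 0# ≤ halves j ρ
  halves-nonNeg zero    0≤ρ = 0≤ρ
  halves-nonNeg (suc j) 0≤ρ = halves-nonNeg j (half-nonNeg 0≤ρ)

  module Packing {d : ℕ} (doubling : Doubling X d) where

    cover : ∀ j x ρ → 0# ≤ ρ → Σ (Fin ((2 ℕ.^ d) ℕ.^ j) → Point) λ c →
            ∀ y → InBall X x ρ y → InBalls X c (halves j ρ) y
    cover zero x ρ 0≤ρ = (λ _ → x) , λ y y∈ → zero , y∈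
    cover (suc j) x ρ 0≤ρ with doubling x ρ 0≤ρ
    ... | c , covers = c′ , covers′
      where
      sub : ∀ i → _
      sub i = cover j (c i) (half ρ) (half-nonNeg 0≤ρ)
      c′ : Fin (2 ℕ.^ d ℕ.* (2 ℕ.^ d) ℕ.^ j) → Point
      c′ e = let i , i′ = remQuot {2 ℕ.^ d} ((2 ℕ.^ d) ℕ.^ j) e in proj₁ (sub i) i′
      covers′ : ∀ y → InBall X x ρ y → InBalls X c′ (halves j (half ρ)) y
      covers′ y y∈ with covers y y∈
      ... | i , y∈i with proj₂ (sub i) y y∈i
      ...   | i′ , y∈i′ = combine i i′ ,
        ≡.subst (λ e → dist (proj₁ (sub (proj₁ e)) (proj₂ e)) y ≤ halves j (half ρ))
          (≡.sym (Fin.remQuot-combine {n = 2 ℕ.^ d} i i′)) y∈i′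

    covers : ∀ j {k} (c : Fin k → Point) r → 0# ≤ r → Σ (Fin (k ℕ.* (2 ℕ.^ d) ℕ.^ j) → Point) λ c′ →
             ∀ y → InBalls X c r y → InBalls X c′ (halves j r) y
    covers j {k} c r 0≤r = c′ , covers′
      where
      sub : ∀ i → _
      sub i = cover j (c i) r 0≤r
      c′ : Fin (k ℕ.* (2 ℕ.^ d) ℕ.^ j) → Point
      c′ e = let i , i′ = remQuot {k} ((2 ℕ.^ d) ℕ.^ j) e in proj₁ (sub i) i′
      covers′ : ∀ y → InBalls X c r y → InBalls X c′ (halves j r) y
      covers′ y (i , y∈i) with proj₂ (sub i) y y∈i
      ... | i′ , y∈i′ = combine i i′ ,
        ≡.subst (λ e → dist (proj₁ (sub (proj₁ e)) (proj₂ e)) y ≤ halves j r)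
          (≡.sym (Fin.remQuot-combine {n = k} i i′)) y∈i′

    -- Pigeonhole on the balls of radius r / 2 ^ j: two points in the same ball are within 2 r / 2 ^
    -- j ≤ ε r of each other, contradicting separation.
    separated-covered : ∀ {ε j k} (c : Fin k → Point) r → 0# ≤ r → 1# + 1# ≤ ε * fromℕ (2 ℕ.^ j) →
                        ∀ L → Separated (ε * r) L → All (InBalls X c r) L →
                        length L ℕ.≤ k ℕ.* (2 ℕ.^ d) ℕ.^ j
    separated-covered {ε} {j} {k} c r 0≤r 2≤ε2^j L sep covered = ℕ.≮⇒≥ λ big →
      let x , y , x<y , eq = Fin.pigeonhole big index in
      <⇒≱ (allPairs-lookup sep x<y) (close x y eq)
      where
      open ≤-Reasoning
      c′ = proj₁ (covers j c r 0≤r)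
      s = halves j r
      inBall : ∀ x → InBalls X c′ s (List.lookup L x)
      inBall x = proj₂ (covers j c r 0≤r) _ (All.lookup covered (∈-lookup x))
      index : Fin (length L) → Fin (k ℕ.* (2 ℕ.^ d) ℕ.^ j)
      index x = proj₁ (inBall x)
      2s≤εr : s + s ≤ ε * r
      2s≤εr = begin
        s + s                               ≈⟨ +-cong (sym (*-identityˡ s)) (sym (*-identityˡ s)) ⟩
        1# * s + 1# * s                     ≈⟨ distribʳ s 1# 1# ⟨
        (1# + 1#) * s                       ≤⟨ *-monoʳ s (halves-nonNeg j 0≤r) 2≤ε2^j ⟩
        ε * fromℕ (2 ℕ.^ j) * s             ≈⟨ *-assoc ε _ s ⟩
        ε * (fromℕ (2 ℕ.^ j) * s)           ≈⟨ *-congˡ (*-comm _ s) ⟩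
        ε * (s * fromℕ (2 ℕ.^ j))           ≈⟨ *-congˡ (double-halves j r) ⟩
        ε * r                               ∎
      close : ∀ x y → index x ≡ index y → dist (List.lookup L x) (List.lookup L y) ≤ ε * r
      close x y eq = begin
        dist (List.lookup L x) (List.lookup L y)                                      ≤⟨ triangle _ (c′ (index x)) _ ⟩
        dist (List.lookup L x) (c′ (index x)) + dist (c′ (index x)) (List.lookup L y) ≤⟨ +-mono
          (≤-trans (≤-reflexive (dist-sym _ _)) (proj₂ (inBall x)))
          (≡.subst (λ i → dist (c′ i) (List.lookup L y) ≤ s) (≡.sym eq) (proj₂ (inBall y))) ⟩
        s + s                                                               ≤⟨ 2s≤εr ⟩
        ε * r                                                               ∎

    -- Points outside the balls may be spread out arbitrarily, so they are merely counted; in the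
    -- application they are outliers on one machine.
    separated-size : ∀ {ε j k} (c : Fin k → Point) r → 0# ≤ r → 1# + 1# ≤ ε * fromℕ (2 ℕ.^ j) →
                     ∀ {L Q} → L ⊑ Q → Separated (ε * r) L →
                     length L ℕ.≤ k ℕ.* (2 ℕ.^ d) ℕ.^ j ℕ.+ count (λ y → ¬? (inBalls? X c r y)) Q
    separated-size {ε} {j} c r 0≤r 2≤ {L} L⊑Q sep =
      ≡.subst (ℕ._≤ _) (count-complement (inBalls? X c r) L)
        (ℕ.+-mono-≤
          (separated-covered {ε} {j} c r 0≤r 2≤ (filter (inBalls? X c r) L)
            (AllPairs.filter⁺ (inBalls? X c r) sep) (All.all-filter (inBalls? X c r) L))
          (count-sublist (λ y → ¬? (inBalls? X c r y)) L⊑Q))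

-- Sums over the machines, and the number of workers.

sum-+ : ∀ (f g : A → ℕ) xs → sum (map (λ x → f x ℕ.+ g x) xs) ≡ sum (map f xs) ℕ.+ sum (map g xs)
sum-+ f g [] = ≡.refl
sum-+ f g (x ∷ xs) = ≡.trans (≡.cong (f x ℕ.+ g x ℕ.+_) (sum-+ f g xs)) (interchange (f x) (g x) (sum (map f xs)) (sum (map g xs)))
  where
  interchange : ∀ i j k l → i ℕ.+ j ℕ.+ (k ℕ.+ l) ≡ i ℕ.+ k ℕ.+ (j ℕ.+ l)
  interchange = solve-∀

sum-mono : ∀ {f g : A → ℕ} → (∀ x → f x ℕ.≤ g x) → ∀ xs → sum (map f xs) ℕ.≤ sum (map g xs)
sum-mono f≤g [] = ℕ.z≤n
sum-mono f≤g (x ∷ xs) = ℕ.+-mono-≤ (f≤g x) (sum-mono f≤g xs)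

sum-zeros : ∀ (xs : List A) → sum (map (λ _ → 0) xs) ≡ 0
sum-zeros [] = ≡.refl
sum-zeros (_ ∷ xs) = sum-zeros xs

sum-single : ∀ {m} (x : Fin m) c → sum (map (λ i → if does (x Fin.≟ i) then c else 0) (allFin m)) ≡ c
sum-single {suc m} x c = ≡.trans (≡.cong (λ is → sum (map f is)) (allFin-suc m))
  (≡.trans (≡.cong (λ ns → f zero ℕ.+ sum ns) (≡.sym (map-∘ (allFin m)))) (go x))
  where
  f : Fin (suc m) → ℕ
  f i = if does (x Fin.≟ i) then c else 0
  go : ∀ x → (if does (x Fin.≟ zero) then c else 0) ℕ.+
             sum (map (λ i → if does (x Fin.≟ suc i) then c else 0) (allFin m)) ≡ c
  go zero    = ≡.trans (≡.cong (c ℕ.+_) (sum-zeros (allFin m))) (ℕ.+-identityʳ c)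
  go (suc x) = sum-single x c

module _ {P : Pred A p} (P? : Decidable P) {m : ℕ} (f : A → Fin m) where

  count-partition : ∀ xs → count P? xs ≡ sum (map (λ i → count P? (filter (λ x → f x Fin.≟ i) xs)) (allFin m))
  count-partition [] = ≡.sym (sum-zeros (allFin m))
  count-partition (x ∷ xs) = begin
    count P? (x ∷ xs)                                    ≡⟨ count-∷ P? x xs ⟩
    indicator P? x ℕ.+ count P? xs                       ≡⟨ ≡.cong₂ ℕ._+_ (≡.sym (sum-single (f x) _)) (count-partition xs) ⟩
    sum (map (λ i → if does (f x Fin.≟ i) then indicator P? x else 0) (allFin m)) ℕ.+ sum (map part (allFin m))
                                                         ≡⟨ sum-+ _ part (allFin m) ⟨
    sum (map (λ i → (if does (f x Fin.≟ i) then indicator P? x else 0) ℕ.+ part i) (allFin m))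
                                                         ≡⟨ ≡.cong sum (map-cong step (allFin m)) ⟩
    sum (map (λ i → count P? (filter (λ x → f x Fin.≟ i) (x ∷ xs))) (allFin m)) ∎
    where
    open ≡.≡-Reasoning
    part : Fin m → ℕ
    part i = count P? (filter (λ x → f x Fin.≟ i) xs)
    step : ∀ i → (if does (f x Fin.≟ i) then indicator P? x else 0) ℕ.+ part i ≡
                 count P? (filter (λ x → f x Fin.≟ i) (x ∷ xs))
    step i with does (f x Fin.≟ i)
    ... | false = ≡.refl
    ... | true  = ≡.sym (count-∷ P? x _)

weight-concatMap : ∀ {b} {B : Set b} {P : Pred A p} (P? : Decidable P) (f : B → List (A × ℕ)) xs →
                   weight P? (concatMap f xs) ≡ sum (map (weight P? ∘ f) xs)
weight-concatMap P? f [] = ≡.refl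
weight-concatMap P? f (x ∷ xs) =
  ≡.trans (weight-++ P? (f x) (concatMap f xs)) (≡.cong (weight P? (f x) ℕ.+_) (weight-concatMap P? f xs))

length-concatMap-≤ : ∀ {b} {B : Set b} (f : B → List A) c → (∀ x → length (f x) ℕ.≤ c) →
                     ∀ xs → length (concatMap f xs) ℕ.≤ length xs ℕ.* c
length-concatMap-≤ f c f≤c [] = ℕ.z≤n
length-concatMap-≤ f c f≤c (x ∷ xs) =
  ℕ.≤-trans (ℕ.≤-reflexive (length-++ (f x))) (ℕ.+-mono-≤ (f≤c x) (length-concatMap-≤ f c f≤c xs))

∣tabulate∣ : ∀ {n} {P : Pred (Fin n) p} (P? : Decidable P) → ∣ Vec.tabulate (does ∘ P?) ∣ ≡ count P? (allFin n)
∣tabulate∣ {n = zero} P? = ≡.refl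
∣tabulate∣ {n = suc n} P? = ≡.trans (head (does (P? zero)) (Vec.tabulate (does ∘ P? ∘ suc)))
  (≡.trans (≡.cong (indicator P? zero ℕ.+_) (≡.trans (∣tabulate∣ (P? ∘ suc)) (≡.sym (count-map P? suc (allFin n)))))
    (≡.trans (≡.sym (count-∷ P? zero _)) (≡.cong (count P?) (≡.sym (allFin-suc n)))))
  where
  head : ∀ b (Z : Subset n) → ∣ b ∷ Z ∣ ≡ (if b then 1 else 0) ℕ.+ ∣ Z ∣
  head false _ = ≡.refl
  head true  _ = ≡.refl

-- The witness is ⌊√(n / K)⌋. Raising n by one raises it by at most one, which `strict` verifies.
floor-root : ∀ K → 1 ℕ.≤ K → ∀ n → ∃ λ w → w ℕ.* w ℕ.* K ℕ.≤ n × n ℕ.< suc w ℕ.* suc w ℕ.* K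
floor-root K 1≤K zero = 0 , ℕ.z≤n , ℕ.≤-trans 1≤K (ℕ.≤-reflexive (≡.sym (ℕ.*-identityˡ K)))
floor-root K 1≤K (suc n) with floor-root K 1≤K n
... | w , lower , upper with suc n ℕ.<? suc w ℕ.* suc w ℕ.* K
...   | yes lt = w , ℕ.m≤n⇒m≤1+n lower , lt
...   | no  ge = suc w , ℕ.≮⇒≥ ge , ℕ.<-≤-trans (ℕ.s≤s upper) (strict w K 1≤K)
  where
  strict : ∀ w K → 1 ℕ.≤ K → suc (suc w ℕ.* suc w ℕ.* K) ℕ.≤ suc (suc w) ℕ.* suc (suc w) ℕ.* K
  strict w K 1≤K = ℕ.≤-trans (ℕ.+-monoˡ-≤ (suc w ℕ.* suc w ℕ.* K) 1≤K)
    (ℕ.≤-trans (ℕ.m≤m+n _ ((2 ℕ.* w ℕ.+ 2) ℕ.* K)) (ℕ.≤-reflexive (eq w K)))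
    where
    eq : ∀ w K → K ℕ.+ (1 ℕ.+ w) ℕ.* (1 ℕ.+ w) ℕ.* K ℕ.+ (2 ℕ.* w ℕ.+ 2) ℕ.* K ≡ (2 ℕ.+ w) ℕ.* (2 ℕ.+ w) ℕ.* K
    eq = solve-∀

-- Encoding weighted points as words.

module Words {ℓ : Level} {A : Set ℓ} where

  points : Memory A → List A
  points [] = []
  points (point x ∷ M)  = x ∷ points M
  points (number _ ∷ M) = points M

  encode : List (A × ℕ) → Memory A
  encode [] = []
  encode ((x , k) ∷ B) = point x ∷ number k ∷ encode B

  -- Stops at anything that is not a pair; on concatenated encodings this is only the end. Pairs
  -- have fixed width, so messages need no delimiters.
  decode : Memory A → List (A × ℕ)
  decode (point x ∷ number k ∷ M) = (x , k) ∷ decode M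
  decode _ = []

  points-map : ∀ {b} {B : Set b} (f : B → A) xs → points (map (point ∘ f) xs) ≡ map f xs
  points-map f [] = ≡.refl
  points-map f (x ∷ xs) = ≡.cong (f x ∷_) (points-map f xs)

  decode-encode-++ : ∀ B M → decode (encode B ++ M) ≡ B ++ decode M
  decode-encode-++ [] M = ≡.refl
  decode-encode-++ (b ∷ B) M = ≡.cong (b ∷_) (decode-encode-++ B M)

  decode-concatMap : ∀ {b} {B : Set b} (f : B → List (A × ℕ)) xs →
                     decode (concatMap (encode ∘ f) xs) ≡ concatMap f xs
  decode-concatMap f [] = ≡.refl
  decode-concatMap f (x ∷ xs) =
    ≡.trans (decode-encode-++ (f x) _) (≡.cong (f x ++_) (decode-concatMap f xs))

  length-encode : ∀ B → length (encode B) ≡ 2 ℕ.* length B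
  length-encode [] = ≡.refl
  length-encode (_ ∷ B) = ≡.trans (≡.cong (λ e → suc (suc e)) (length-encode B)) (≡.sym (ℕ.*-suc 2 (length B)))

-- Optimal radii, a coreset criterion and optimal outliers.

module Clustering {ℓ : Level} {ℝ : CompleteOrderedField ℓ} (X : MetricSpace ℝ) where

  open CompleteOrderedField ℝ
  open Field ℝ
  open MetricSpace X
  open Metric X
  import Relation.Binary.Reasoning.PartialOrder (DecTotalOrder.poset decTotalOrder) as ≤-Reasoning

  Uncovered : ∀ {k} → (Fin k → Point) → Carrier → Point → Set ℓ
  Uncovered c r y = ¬ InBalls X c r y

  uncovered? : ∀ {k} (c : Fin k → Point) r → Decidable (Uncovered c r)
  uncovered? c r y = ¬? (inBalls? X c r y)

  uncovered-mono : ∀ {k} (c : Fin k → Point) {r s x y} → r + dist y x ≤ s → Uncovered c s x → Uncovered c r y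
  uncovered-mono c r+≤s ∉ (i , y∈i) = ∉ (i , ≤-trans (triangle (c i) _ _) (≤-trans (+-mono y∈i ≤-refl) r+≤s))

  nonNeg-lowerBound : ∀ {k z B} → IsLowerBound (Feasible X k z B) 0#
  nonNeg-lowerBound r (0≤r , _) = 0≤r

  -- All k centres are put at one point, with the sum of its distances as radius. This gives the
  -- nonempty set needed for the infimum.
  feasible : ∀ {k} .⦃ _ : NonZero k ⦄ z → Point → ∀ B → ∃ (Feasible X k z B)
  feasible {suc k} z x B with radius B
    where
    radius : ∀ B → ∃ λ r → 0# ≤ r × All (λ b → dist x (proj₁ b) ≤ r) B
    radius [] = 0# , ≤-refl , []
    radius ((y , _) ∷ B) with radius B
    ... | r , 0≤r , near = r + dist x y , +-nonNeg 0≤r (0≤dist x y) ,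
      ≤-trans (x≤x+y 0≤r) (≤-reflexive (+-comm (dist x y) r)) ∷
      All.map (λ d≤r → ≤-trans d≤r (x≤x+y (0≤dist x y))) near
  ... | r , 0≤r , near = r , 0≤r , (λ _ → x) , ℕ.≤-trans (ℕ.≤-reflexive
    (≡.cong (sum ∘ map proj₂) (filter-none (λ b → uncovered? {suc k} (λ _ → x) r (proj₁ b))
      (All.map (λ d≤r ∉ → ∉ (zero , d≤r)) near)))) ℕ.z≤n

  optimum : ∀ {k} .⦃ _ : NonZero k ⦄ z → Point → ∀ B → ∃ (IsOpt X k z B)
  optimum z x B = infimum (Feasible X _ z B) (feasible z x B) (0# , nonNeg-lowerBound {B = B})

  0≤opt : ∀ {k z B opt} → IsOpt X k z B opt → 0# ≤ opt
  0≤opt {B = B} (_ , greatest) = greatest 0# (nonNeg-lowerBound {B = B})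

  -- By the two inequalities, a radius feasible for one set becomes feasible for the other when
  -- raised by ε opt. Hence each optimum minus ε opt is a lower bound for the feasible radii of the
  -- other set. The covering condition is the first inequality itself.
  coreset : ∀ {k} .⦃ _ : NonZero k ⦄ {z ε A A* opt} → Point → 0# ≤ ε → IsOpt X k z A opt →
            IsWeightedSet X A* → map proj₁ A* ⊆ map proj₁ A →
            (∀ (c : Fin k → Point) r → uncoveredWeight X c (r + ε * opt) A ℕ.≤ uncoveredWeight X c r A*) →
            (∀ (c : Fin k → Point) r → uncoveredWeight X c (r + ε * opt) A* ℕ.≤ uncoveredWeight X c r A) →
            IsCoreset X ε k z A A*
  coreset {k} {z} {ε} {A} {A*} {opt} x 0≤ε isOpt weighted subset A≤A* A*≤A =
    weighted , subset , opt , opt* , isOpt , isOpt* , lower , upper ,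
    λ c r _ ≤z → ℕ.≤-trans (A≤A* c r) ≤z
    where
    open ≤-Reasoning
    opt* = proj₁ (optimum {k} z x A*)
    isOpt* = proj₂ (optimum {k} z x A*)
    0≤εopt : 0# ≤ ε * opt
    0≤εopt = *-nonNeg 0≤ε (0≤opt {k} {z} {B = A} isOpt)
    enlarge : ∀ {B C} → (∀ (c : Fin k → Point) r → uncoveredWeight X c (r + ε * opt) B ℕ.≤ uncoveredWeight X c r C) →
              ∀ {r} → Feasible X k z C r → Feasible X k z B (r + ε * opt)
    enlarge B≤C (0≤r , c , ≤z) = +-nonNeg 0≤r 0≤εopt , c , ℕ.≤-trans (B≤C c _) ≤z
    minus : ∀ {x y} → x ≤ y + ε * opt → x + - (ε * opt) ≤ y
    minus {x} {y} h = +-cancel (ε * opt) (≤-trans (≤-reflexive (sub-add (ε * opt) x)) h)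
    lower : (1# + - ε) * opt ≤ opt*
    lower = begin
      (1# + - ε) * opt          ≈⟨ distribʳ opt 1# (- ε) ⟩
      1# * opt + - ε * opt      ≈⟨ +-cong (*-identityˡ opt) (sym (-‿distribˡ-* ε opt)) ⟩
      opt + - (ε * opt)         ≤⟨ proj₂ isOpt* _ (λ r fr → minus (proj₁ isOpt _ (enlarge {A} {A*} A≤A* fr))) ⟩
      opt*                      ∎
      where open import Algebra.Properties.Ring ring using (-‿distribˡ-*)
    upper : opt* ≤ (1# + ε) * opt
    upper = begin
      opt*                              ≈⟨ sub-add (ε * opt) opt* ⟨
      opt* + - (ε * opt) + ε * opt      ≤⟨ +-mono (proj₂ isOpt _ (λ r fr → minus (proj₁ isOpt* _ (enlarge {A*} {A} A*≤A fr)))) ≤-refl ⟩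
      opt + ε * opt                     ≈⟨ +-congʳ (*-identityˡ opt) ⟨
      1# * opt + ε * opt                ≈⟨ distribʳ opt 1# ε ⟨
      (1# + ε) * opt                    ∎

  unitWeights-count : ∀ {n} (P : Fin n ↣ Point) {p} {V : Pred Point p} (V? : Decidable V) →
                      weight V? (unitWeights X P) ≡ count (V? ∘ Injection.to P) (allFin n)
  unitWeights-count {n} P V? = ≡.trans (≡.cong (weight V?) (map-∘ {g = λ x → x , 1} {f = Injection.to P} (allFin n)))
    (≡.trans (weight-units V? (map (Injection.to P) (allFin n))) (count-map V? (Injection.to P) (allFin n)))

  -- Interchanging ¬ ¬ with the finite quantifier over subsets: take the smaller of two radii.
  common-radius : ∀ {n} {o : Carrier} (F : Subset n → Carrier → Set ℓ) →
                  (∀ Z {r s} → r ≤ s → F Z s → F Z r) →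
                  (∀ Z → ¬ ¬ ∃ λ r → o < r × F Z r) → ¬ ¬ ∃ λ r → o < r × ∀ Z → F Z r
  common-radius {zero} F anti each none = each [] λ (r , o<r , Fr) → none (r , o<r , λ { [] → Fr })
  common-radius {suc n} F anti each none =
    common-radius (F ∘ (inside ∷_)) (anti ∘ (inside ∷_)) (each ∘ (inside ∷_)) λ (r , o<r , Fr) →
    common-radius (F ∘ (outside ∷_)) (anti ∘ (outside ∷_)) (each ∘ (outside ∷_)) λ (s , o<s , Fs) →
    none (smaller r s o<r o<s Fr Fs)
    where
    smaller : ∀ r s → _ < r → _ < s → (∀ Z → F (inside ∷ Z) r) → (∀ Z → F (outside ∷ Z) s) → ∃ λ t → _ < t × ∀ Z → F Z t
    smaller r s o<r o<s Fr Fs with total r s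
    ... | inj₁ r≤s = r , o<r , λ { (inside ∷ Z) → Fr Z ; (outside ∷ Z) → anti (outside ∷ Z) r≤s (Fs Z) }
    ... | inj₂ s≤r = s , o<s , λ { (inside ∷ Z) → anti (inside ∷ Z) s≤r (Fr Z) ; (outside ∷ Z) → Fs Z }

  module Outliers {n k z : ℕ} (P : Fin n ↣ Point) {opt : Carrier} (isOpt : IsOpt X k z (unitWeights X P) opt) where

    CoveredExcept : Subset n → Carrier → Set ℓ
    CoveredExcept Z r = Σ (Fin k → Point) λ c → ∀ j → lookup Z j ≢ inside → InBalls X c r (Injection.to P j)

    -- The inner double negation makes the property stable, so that `weak-excluded-middle` decides
    -- it.
    OptimalOutliers : Subset n → Set ℓ
    OptimalOutliers Z = ∀ r → opt < r → ¬ ¬ CoveredExcept Z r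

    -- The optimum need not be attained, but by finiteness one set of outliers serves all r > opt.
    outliers : ∃ λ Z → ∣ Z ∣ ℕ.≤ z × OptimalOutliers Z
    outliers with Subset.anySubset? (λ Z → ∣ Z ∣ ℕ.≤? z ×-dec optimal? Z)
      where
      optimal? : ∀ Z → Dec (OptimalOutliers Z)
      optimal? Z with weak-excluded-middle (OptimalOutliers Z)
      ... | inj₁ ¬opt  = no ¬opt
      ... | inj₂ ¬¬opt = yes λ r opt<r ¬cov → ¬¬opt λ cov → cov r opt<r ¬cov
    ... | yes found = found
    -- If every `Z` of size at most z failed at some radius above opt, all would fail at a common
    -- one, by `common-radius`. That radius would be a lower bound for the feasible radii, although
    -- it exceeds their infimum.
    ... | no  none  = contradiction tight (common-radius F anti each)
      where
      F : Subset n → Carrier → Set ℓ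
      F Z r = ∣ Z ∣ ℕ.≤ z → ¬ CoveredExcept Z r
      anti : ∀ Z {r s} → r ≤ s → F Z s → F Z r
      anti Z r≤s ¬cov ∣Z∣≤z (c , cov) = ¬cov ∣Z∣≤z (c , λ j ∉ → let i , ∈i = cov j ∉ in i , ≤-trans ∈i r≤s)
      each : ∀ Z → ¬ ¬ ∃ λ r → opt < r × F Z r
      each Z ¬r with ∣ Z ∣ ℕ.≤? z
      ... | yes ∣Z∣≤z = none (Z , ∣Z∣≤z , λ r opt<r ¬cov → ¬r (r , opt<r , λ _ → ¬cov))
      ... | no  ∣Z∣≰z = ¬r (opt + 1# , x<x+1 opt , λ ∣Z∣≤z → contradiction ∣Z∣≤z ∣Z∣≰z)
      tight : ¬ ∃ λ r → opt < r × ∀ Z → F Z r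
      tight (r , opt<r , ¬cov) = <⇒≱ opt<r (proj₂ isOpt r (bounded r ¬cov))
        where
        bounded : ∀ r → (∀ Z → F Z r) → IsLowerBound (Feasible X k z (unitWeights X P)) r
        bounded r ¬cov s (0≤s , c , uncovered≤z) with r ≤? s
        ... | yes r≤s = r≤s
        ... | no  r≰s = contradiction (c , covered) (anti Z (≰⇒≥ r≰s) (¬cov Z) ∣Z∣≤z)
          where
          U? = λ j → uncovered? c s (Injection.to P j)
          Z : Subset n
          Z = Vec.tabulate (does ∘ U?)
          ∣Z∣≤z : ∣ Z ∣ ℕ.≤ z
          ∣Z∣≤z = ≡.subst (ℕ._≤ z) (≡.trans (unitWeights-count P (uncovered? c s)) (≡.sym (∣tabulate∣ U?))) uncovered≤z
          covered : ∀ j → lookup Z j ≢ inside → InBalls X c s (Injection.to P j)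
          covered j j∉Z = decidable-stable (inBalls? X c s (Injection.to P j)) λ ∉ →
            j∉Z (≡.trans (Vec.lookup∘tabulate (does ∘ U?) j) (dec-true (U? j) ∉))
            where open import Relation.Nullary.Decidable using (dec-true)

-- Arithmetic of the coordinator's memory.

module CoordinatorBound where

  open import Data.Nat.Base using (_+_; _*_; _≤_)
  open import Data.Nat.Properties using (module ≤-Reasoning)
  open ≤-Reasoning

  -- For w = 0 the estimate through K is useless, as K may exceed √(n K); the load bound `t` of the
  -- single machine replaces it. For w ≥ 1, m ≤ 2 w, and w² K ≤ n gives (w K)² ≤ n K.
  coordinator-bound : ∀ w {K n t s G z x} → w * w * K ≤ n → 1 ≤ K → t * t ≤ 256 * (n * K) →
                      suc w * s ≤ 2 * z + 11 * (suc w * G) → x ≤ 4 * (suc w * t) → x ≤ 4 * (suc w * (K + s)) →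
                      ∃ λ M → M * M ≤ 96 * 96 * (n * K) × 3 * t ≤ M × x ≤ M + (88 * (w * G) + 8 * z)
  coordinator-bound zero {K} {n} {t} _ _ t² _ x≤ _ = 4 * t ,
    (begin
      4 * t * (4 * t)       ≡⟨ eq t ⟩
      16 * (t * t)          ≤⟨ ℕ.*-mono-≤ (ℕ.m≤m+n 16 20) t² ⟩
      36 * (256 * (n * K))  ≡⟨ ℕ.*-assoc 36 256 (n * K) ⟨
      96 * 96 * (n * K)     ∎) ,
    ℕ.*-monoˡ-≤ t (ℕ.m≤m+n 3 1) ,
    ℕ.≤-trans x≤ (ℕ.≤-trans (ℕ.≤-reflexive (≡.cong (4 *_) (ℕ.*-identityˡ t))) (ℕ.m≤m+n (4 * t) _))
    where
    eq : ∀ t → 4 * t * (4 * t) ≡ 16 * (t * t)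
    eq = solve-∀
  -- In the witness, 3 t pays for the first round. The term 8 w K ≥ 4 m K pays for the regular net
  -- points, each taking two words on receipt and two in the output.
  coordinator-bound w@(suc v) {K} {n} {t} {s} {G} {z} {x} w²K≤n 1≤K t² share≤ _ x≤ = 3 * t + 8 * (w * K) ,
    (begin
      (3 * t + 8 * (w * K)) * (3 * t + 8 * (w * K))      ≤⟨ square-sum (3 * t) (8 * (w * K)) ⟩
      2 * (3 * t * (3 * t)) + 2 * (8 * (w * K) * (8 * (w * K)))
                                                         ≡⟨ eq₁ t w K ⟩
      18 * (t * t) + 128 * (w * w * K * K)               ≤⟨ ℕ.+-mono-≤ (ℕ.*-monoʳ-≤ 18 t²) (ℕ.*-monoʳ-≤ 128 (ℕ.*-monoˡ-≤ K w²K≤n)) ⟩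
      18 * (256 * (n * K)) + 128 * (n * K)               ≡⟨ eq₂ (n * K) ⟩
      4736 * (n * K)                                     ≤⟨ ℕ.*-monoˡ-≤ (n * K) (ℕ.m≤m+n 4736 4480) ⟩
      96 * 96 * (n * K)                                  ∎) ,
    ℕ.m≤m+n (3 * t) _ ,
    (begin
      x                                                         ≤⟨ x≤ ⟩
      4 * (suc w * (K + s))                                     ≡⟨ eq₃ (suc w) K s ⟩
      4 * (suc w * K) + 4 * (suc w * s)                         ≤⟨ ℕ.+-mono-≤ (ℕ.*-monoʳ-≤ 4 (ℕ.*-monoˡ-≤ K 1+w≤2w)) (ℕ.*-monoʳ-≤ 4 share≤) ⟩
      4 * (2 * w * K) + 4 * (2 * z + 11 * (suc w * G))          ≤⟨ ℕ.+-monoʳ-≤ (4 * (2 * w * K)) (ℕ.*-monoʳ-≤ 4 (ℕ.+-monoʳ-≤ (2 * z) (ℕ.*-monoʳ-≤ 11 (ℕ.*-monoˡ-≤ G 1+w≤2w)))) ⟩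
      4 * (2 * w * K) + 4 * (2 * z + 11 * (2 * w * G))          ≡⟨ eq₄ w K z G ⟩
      8 * (w * K) + (88 * (w * G) + 8 * z)                      ≤⟨ ℕ.+-monoˡ-≤ _ (ℕ.m≤n+m (8 * (w * K)) (3 * t)) ⟩
      3 * t + 8 * (w * K) + (88 * (w * G) + 8 * z)              ∎)
    where
    1+w≤2w : suc w ≤ 2 * w
    1+w≤2w = ℕ.≤-trans (ℕ.+-monoˡ-≤ w (ℕ.s≤s ℕ.z≤n)) (ℕ.≤-reflexive (≡.cong (w +_) (≡.sym (ℕ.+-identityʳ w))))
    eq₁ : ∀ t w K → 2 * (3 * t * (3 * t)) + 2 * (8 * (w * K) * (8 * (w * K))) ≡ 18 * (t * t) + 128 * (w * w * K * K)
    eq₁ = solve-∀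
    eq₂ : ∀ x → 18 * (256 * x) + 128 * x ≡ 4736 * x
    eq₂ = solve-∀
    eq₃ : ∀ m K s → 4 * (m * (K + s)) ≡ 4 * (m * K) + 4 * (m * s)
    eq₃ = solve-∀
    eq₄ : ∀ w K z G → 4 * (2 * w * K) + 4 * (2 * z + 11 * (2 * w * G)) ≡ 8 * (w * K) + (88 * (w * G) + 8 * z)
    eq₄ = solve-∀

open CoordinatorBound using (coordinator-bound)

-- The algorithm and its analysis.

module Construction {ℓ : Level} {ℝ : CompleteOrderedField ℓ} (X : MetricSpace ℝ) {d : ℕ} (doubling : Doubling X d)
                    (n k z : ℕ) .⦃ _ : NonZero k ⦄
                    (ε : CompleteOrderedField.Carrier ℝ)
                    (0<ε : CompleteOrderedField._<_ ℝ (CompleteOrderedField.0# ℝ) ε)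
                    (ε≤1 : CompleteOrderedField._≤_ ℝ ε (CompleteOrderedField.1# ℝ)) where

  open CompleteOrderedField ℝ
  open Field ℝ
  open MetricSpace X
  open Metric X
  open Packing {d} doubling
  open Clustering X
  open Words {A = Point}
  open Scale ℝ d n k (ℕ.>-nonZero⁻¹ k) ε 0<ε ε≤1 using (NetSize; netSize-exists; balls; module Bounds)

  module WithWorkers (N : NetSize) (w : ℕ) (w²K≤n : w ℕ.* w ℕ.* NetSize.K N ℕ.≤ n)
                     (n<m²K : n ℕ.< suc w ℕ.* suc w ℕ.* NetSize.K N) where

    open NetSize N
    open Bounds N
    open Loads n w using (m; share; slack; Balanced; balanced; share-total; slack-square)

    module Compressed (Q : List Point) = Compression (K ℕ.+ share z) Q
    open Compressed using (compressed)

    -- The coordinator sends its net to itself and keeps nothing, so all machines act alike and its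
    -- final memory is a plain concatenation of encoded nets.
    step : Fin m → Memory Point → Step Point m
    step _ M = record { kept = [] ; send = λ { zero → encode (compressed (points M)) ; (suc _) → [] } }

    algorithm : Algorithm Point m 1
    algorithm = round step (finish decode)

    -- Here 96 = 6 * 16: a load is at most 16 √(n K), and the 6 leaves room for several words per
    -- point. The factor 2 ^ d is the root of the 4 ^ d in the bound on K.
    constant : ℕ
    constant = 96 ℕ.* 2 ℕ.^ d

    private
      1≤constant : 1 ℕ.≤ constant
      1≤constant = ℕ.*-mono-≤ {1} {96} (ℕ.s≤s ℕ.z≤n) (ℕ.m^n>0 2 d)

      scale-up : ∀ {c x} → c ℕ.≤ constant → 0# ≤ x → fromℕ c * x ≤ fromℕ constant * x
      scale-up c≤ 0≤x = *-monoʳ _ 0≤x (fromℕ-mono c≤)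

    few-workers : fromℕ w ≤ fromℕ constant * S
    few-workers = ≤-trans (w≤S w w²K≤n) (≤-trans (≤-reflexive (sym (trans (*-congʳ fromℕ-1) (*-identityˡ S))))
      (scale-up 1≤constant (√-nonNeg _)))

    logTerm : ℕ
    logTerm = ⌊log₂ n ⌋ ℕ.⊓ z

    square-scale : ∀ c {x y} → c ℕ.≤ 6 → x ℕ.* x ℕ.≤ 256 ℕ.* y → c ℕ.* x ℕ.* (c ℕ.* x) ℕ.≤ 96 ℕ.* 96 ℕ.* y
    square-scale c {x} {y} c≤6 x²≤ = begin
      c ℕ.* x ℕ.* (c ℕ.* x)       ≡⟨ eq c x ⟩
      c ℕ.* c ℕ.* (x ℕ.* x)       ≤⟨ ℕ.*-mono-≤ (ℕ.*-mono-≤ c≤6 c≤6) x²≤ ⟩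
      36 ℕ.* (256 ℕ.* y)          ≡⟨ ℕ.*-assoc 36 256 y ⟨
      96 ℕ.* 96 ℕ.* y             ∎
      where
      open ℕ.≤-Reasoning
      eq : ∀ c x → c ℕ.* x ℕ.* (c ℕ.* x) ≡ c ℕ.* c ℕ.* (x ℕ.* x)
      eq = solve-∀

    within-T : ∀ M → M ℕ.* M ℕ.≤ 96 ℕ.* 96 ℕ.* (n ℕ.* K) → fromℕ M ≤ fromℕ constant * T
    within-T M = M≤T M 96 (ℕ.s≤s ℕ.z≤n)

    within-coordinator : ∀ M → M ℕ.* M ℕ.≤ 96 ℕ.* 96 ℕ.* (n ℕ.* K) →
                         fromℕ (M ℕ.+ (88 ℕ.* (w ℕ.* logTerm) ℕ.+ 8 ℕ.* z)) ≤ fromℕ constant * (T + S * fromℕ logTerm + fromℕ z)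
    within-coordinator M M²≤ = begin
      fromℕ (M ℕ.+ (88 ℕ.* (w ℕ.* logTerm) ℕ.+ 8 ℕ.* z))
        ≈⟨ trans (fromℕ-+ M _) (+-congˡ (fromℕ-+ (88 ℕ.* (w ℕ.* logTerm)) (8 ℕ.* z))) ⟩
      fromℕ M + (fromℕ (88 ℕ.* (w ℕ.* logTerm)) + fromℕ (8 ℕ.* z))
        ≤⟨ +-mono (within-T M M²≤) (+-mono logs outs) ⟩
      c * T + (c * (S * fromℕ logTerm) + c * fromℕ z)
        ≈⟨ +-congˡ (sym (distribˡ c _ _)) ⟩
      c * T + c * (S * fromℕ logTerm + fromℕ z)
        ≈⟨ sym (distribˡ c _ _) ⟩
      c * (T + (S * fromℕ logTerm + fromℕ z))
        ≈⟨ *-congˡ (sym (+-assoc T _ _)) ⟩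
      c * (T + S * fromℕ logTerm + fromℕ z) ∎
      where
      open import Relation.Binary.Reasoning.PartialOrder (DecTotalOrder.poset decTotalOrder)
      c : Carrier
      c = fromℕ constant
      small : ∀ {b} → b ℕ.≤ 96 → b ℕ.≤ constant
      small {b} b≤96 = ℕ.≤-trans (ℕ.≤-reflexive (≡.sym (ℕ.*-identityʳ b))) (ℕ.*-mono-≤ b≤96 (ℕ.m^n>0 2 d))
      logs : fromℕ (88 ℕ.* (w ℕ.* logTerm)) ≤ c * (S * fromℕ logTerm)
      logs = begin
        fromℕ (88 ℕ.* (w ℕ.* logTerm))            ≈⟨ fromℕ-* 88 (w ℕ.* logTerm) ⟩
        fromℕ 88 * fromℕ (w ℕ.* logTerm)          ≤⟨ scale-up (small (ℕ.m≤m+n 88 8)) (fromℕ-nonNeg (w ℕ.* logTerm)) ⟩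
        c * fromℕ (w ℕ.* logTerm)                 ≈⟨ *-congˡ (fromℕ-* w logTerm) ⟩
        c * (fromℕ w * fromℕ logTerm)             ≤⟨ *-monoˡ c (fromℕ-nonNeg constant) (*-monoʳ _ (fromℕ-nonNeg logTerm) (w≤S w w²K≤n)) ⟩
        c * (S * fromℕ logTerm)                   ∎
      outs : fromℕ (8 ℕ.* z) ≤ c * fromℕ z
      outs = ≤-trans (≤-reflexive (fromℕ-* 8 z)) (scale-up (small (ℕ.m≤m+n 8 88)) (fromℕ-nonNeg z))

    sum-head : ∀ {v} (f : Fin (suc v) → ℕ) → (∀ i → f (suc i) ≡ 0) → sum (map f (allFin (suc v))) ≡ f zero
    sum-head {v} f rest = begin
      sum (map f (allFin (suc v)))                         ≡⟨ ≡.cong (λ is → sum (map f is)) (allFin-suc v) ⟩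
      f zero ℕ.+ sum (map f (map suc (allFin v)))          ≡⟨ ≡.cong (λ ns → f zero ℕ.+ sum ns) (≡.sym (map-∘ (allFin v))) ⟩
      f zero ℕ.+ sum (map (f ∘ suc) (allFin v))            ≡⟨ ≡.cong (λ ns → f zero ℕ.+ sum ns) (map-cong rest (allFin v)) ⟩
      f zero ℕ.+ sum (map (λ _ → 0) (allFin v))            ≡⟨ ≡.cong (f zero ℕ.+_) (sum-zeros (allFin v)) ⟩
      f zero ℕ.+ 0                                         ≡⟨ ℕ.+-identityʳ (f zero) ⟩
      f zero                                               ∎
      where open ≡.≡-Reasoning

    module Run (2≤n : 2 ℕ.≤ n) (P : Fin n ↣ Point) where

      private
        P′ : Fin n → Point
        P′ = Injection.to P

        x₀ : Point
        x₀ = P′ (Fin.fromℕ< (ℕ.≤-trans (ℕ.s≤s ℕ.z≤n) 2≤n))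

        opt : Carrier
        opt = proj₁ (optimum {k} z x₀ (unitWeights X P))

        isOpt : IsOpt X k z (unitWeights X P) opt
        isOpt = proj₂ (optimum {k} z x₀ (unitWeights X P))

      open Outliers {k = k} {z = z} P isOpt

      Z : Subset n
      Z = proj₁ outliers

      ∣Z∣≤z : ∣ Z ∣ ℕ.≤ z
      ∣Z∣≤z = proj₁ (proj₂ outliers)

      module _ (a : Vec (Fin m) n) (fair : Balanced z Z a) where

        private
          mem : Fin m → Memory Point
          mem = initialMemory P a

          Q : Fin m → List Point
          Q i = map P′ (machine a i)

          points-mem : ∀ i → points (mem i) ≡ Q i
          points-mem i = points-map P′ (machine a i)

          part : Fin m → WeightedPoints X
          part i = compressed (points (mem i))

          net-part : ∀ i → Net (Compressed.radius (points (mem i))) (Q i) (part i)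
          net-part i = ≡.subst (λ Q → Net (Compressed.radius (points (mem i))) Q (part i)) (points-mem i)
            (Compressed.compressed-net (points (mem i)))

          -- The radius is strictly above opt because at opt itself a cover need not exist. The goal
          -- is decidable, so the exponent and the cover may both be used although they are known
          -- only up to double negation.
          separated-small : ∀ i r → opt < r → ∀ {L} → L ⊑ points (mem i) → Separated (ε * r) L → length L ℕ.≤ K ℕ.+ share z
          separated-small i r opt<r {L} L⊑ sep = decidable-stable (length L ℕ.≤? K ℕ.+ share z) λ big → packing (big ∘ cases)
            where
            L⊑Q : L ⊑ Q i
            L⊑Q = ≡.subst (L ⊑_) (points-mem i) L⊑
            0≤r : 0# ≤ r
            0≤r = ≤-trans (0≤opt {k} {z} {B = unitWeights X P} isOpt) (proj₁ opt<r)
            exponents : ∀ j → (2 ℕ.^ d) ℕ.^ j ≡ (2 ℕ.^ j) ℕ.^ d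
            exponents j = ≡.trans (ℕ.^-*-assoc 2 d j) (≡.trans (≡.cong (2 ℕ.^_) (ℕ.*-comm d j)) (≡.sym (ℕ.^-*-assoc 2 j d)))
            cases : n ℕ.≤ K ⊎ (∃ λ j → 1# + 1# ≤ ε * fromℕ (2 ℕ.^ j) × balls j ℕ.≤ K) → length L ℕ.≤ K ℕ.+ share z
            cases (inj₁ n≤K) = ℕ.≤-trans (Sublist.length-mono-≤ L⊑Q)
              (ℕ.≤-trans (ℕ.≤-reflexive (length-map P′ (machine a i)))
              (ℕ.≤-trans (length-filter (λ j → lookup a j Fin.≟ i) (allFin n))
              (ℕ.≤-trans (ℕ.≤-reflexive (length-allFin n)) (ℕ.≤-trans n≤K (ℕ.m≤m+n K _)))))
            cases (inj₂ (j , 2≤ , balls≤K)) = decidable-stable (length L ℕ.≤? K ℕ.+ share z) λ big →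
              proj₂ (proj₂ outliers) r opt<r λ (c , cov) →
              big (ℕ.≤-trans (separated-size {ε} {j} c r 0≤r 2≤ L⊑Q sep)
                (ℕ.+-mono-≤ (ℕ.≤-trans (ℕ.≤-reflexive (≡.cong (k ℕ.*_) (exponents j))) balls≤K)
                  (ℕ.≤-trans (ℕ.≤-reflexive (count-map (uncovered? c r) P′ (machine a i)))
                  (ℕ.≤-trans (count-mono (uncovered? c r ∘ P′) (λ j → lookup Z j Bool.≟ inside)
                    (λ j ∉ → decidable-stable (lookup Z j Bool.≟ inside) (∉ ∘ cov j)) (machine a i))
                  (proj₁ (fair i))))))

          small : ∀ i r → opt < r → length (part i) ℕ.≤ K ℕ.+ share z × Compressed.radius (points (mem i)) ≤ ε * r
          small i r opt<r = Compressed.compressed-small (points (mem i))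
            (*-nonNeg (proj₁ 0<ε) (≤-trans (0≤opt {k} {z} {B = unitWeights X P} isOpt) (proj₁ opt<r)))
            (separated-small i r opt<r)

          part-size : ∀ i → length (part i) ℕ.≤ K ℕ.+ share z
          part-size i = proj₁ (small i (opt + 1#) (x<x+1 opt))

          -- The bound ε r holds for each r > opt; dividing by ε > 0 brings it into the form of
          -- `≤-limit`.
          part-radius : ∀ i → Compressed.radius (points (mem i)) ≤ ε * opt
          part-radius i = ≤-trans (*-inverse-bound 0<ε) (≤-trans (*-monoʳ ε (proj₁ 0<ε)
            (≤-limit λ r opt<r → ≤*⇒*⁻¹≤ 0<ε (≤-trans (proj₂ (small i r opt<r)) (≤-reflexive (*-comm ε r)))))
            (≤-reflexive (*-comm opt ε)))
            where
            *-inverse-bound : ∀ {x y} → 0# < y → x ≤ x * y ⁻¹ * y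
            *-inverse-bound {x} {y} 0<y = ≤-reflexive (sym (trans (*-assoc x (y ⁻¹) y)
              (trans (*-congˡ (*-comm (y ⁻¹) y)) (trans (sym (*-assoc x y (y ⁻¹))) (*-inverse-cancel 0<y x)))))

          result : WeightedPoints X
          result = concatMap part (allFin m)

          output≡ : output algorithm mem ≡ result
          output≡ = decode-concatMap part (allFin m)

          count-parts : ∀ {p} {V : Pred Point p} (V? : Decidable V) →
                        weight V? (unitWeights X P) ≡ sum (map (λ i → count V? (Q i)) (allFin m))
          count-parts V? = ≡.trans (unitWeights-count P V?) (≡.trans (count-partition (V? ∘ P′) (lookup a) (allFin n))
            (≡.cong sum (map-cong (λ i → ≡.sym (count-map V? P′ (machine a i))) (allFin m))))

          0≤radius : ∀ i → 0# ≤ Compressed.radius (points (mem i))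
          0≤radius i = Compressed.0≤radius (points (mem i))

          P≤result : ∀ (c : Fin k → Point) r → uncoveredWeight X c (r + ε * opt) (unitWeights X P) ℕ.≤ uncoveredWeight X c r result
          P≤result c r = ≡.subst₂ ℕ._≤_ (≡.sym (count-parts V?)) (≡.sym (weight-concatMap U? part (allFin m)))
            (sum-mono (λ i → net-weight-≥ U? V? (0≤radius i)
              (λ x y near → uncovered-mono c (+-mono ≤-refl (≤-trans near (part-radius i)))) (net-part i)) (allFin m))
            where
            U? = uncovered? c r
            V? = uncovered? c (r + ε * opt)

          result≤P : ∀ (c : Fin k → Point) r → uncoveredWeight X c (r + ε * opt) result ℕ.≤ uncoveredWeight X c r (unitWeights X P)
          result≤P c r = ≡.subst₂ ℕ._≤_ (≡.sym (weight-concatMap U? part (allFin m))) (≡.sym (count-parts V?))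
            (sum-mono (λ i → net-weight-≤ U? V? (0≤radius i)
              (λ x y near → uncovered-mono c (+-mono ≤-refl (≤-trans (≤-reflexive (dist-sym y x)) (≤-trans near (part-radius i))))) (net-part i)) (allFin m))
            where
            U? = uncovered? c (r + ε * opt)
            V? = uncovered? c r

          part-points : ∀ i {x} → x ∈ map proj₁ (part i) → ∃ λ j → x ≡ P′ j × lookup a j ≡ i
          part-points i x∈ with ∈-map⁻ P′ (All.lookup (sublist⇒∈ (net-sublist (net-part i))) x∈)
          ... | j , j∈ , eq = j , eq , proj₂ (∈-filter⁻ (λ j → lookup a j Fin.≟ i) {xs = allFin n} j∈)

          points-result : map proj₁ result ≡ concat (map (map proj₁ ∘ part) (allFin m))
          points-result = map-concatMap proj₁ part (allFin m)

          -- Points of one net differ because their distance exceeds a nonnegative radius. Points of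
          -- different nets differ because `P` is injective and each index lies on one machine.
          weighted : IsWeightedSet X result
          weighted = ≡.subst Unique (≡.sym points-result) (Unique.concat⁺
              (All.map⁺ (All.tabulate λ {i} _ → unique i))
              (AllPairs.map⁺ (AllPairs.map disjoint (Unique.allFin⁺ m)))) ,
            All.concat⁺ {xss = map part (allFin m)} (All.map⁺ (All.tabulate λ {i} _ → net-positive (net-part i)))
            where
            unique : ∀ i → Unique (map proj₁ (part i))
            unique i = AllPairs.map (λ {x} far → λ { ≡.refl → <⇒≱ far (≤-trans (≤-reflexive (dist-self x)) (0≤radius i)) })
              (net-separated (net-part i))
            disjoint : ∀ {i i′} → i ≢ i′ → Disjoint (map proj₁ (part i)) (map proj₁ (part i′))
            disjoint {i} {i′} i≢i′ (x∈i , x∈i′) with part-points i x∈i | part-points i′ x∈i′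
            ... | j , ≡.refl , a≡i | j′ , eq , a≡i′ with Injection.injective P eq
            ...   | ≡.refl = i≢i′ (≡.trans (≡.sym a≡i) a≡i′)

          subset : map proj₁ result ⊆ map proj₁ (unitWeights X P)
          subset x∈ with ∈-concat⁻′ (map (map proj₁ ∘ part) (allFin m)) (≡.subst (_ ∈_) points-result x∈)
          ... | xs , x∈xs , xs∈ with ∈-map⁻ (map proj₁ ∘ part) {xs = allFin m} xs∈
          ...   | i , _ , ≡.refl with part-points i x∈xs
          ...     | j , ≡.refl , _ = ≡.subst (P′ j ∈_) (map-∘ {g = proj₁} {f = λ j → P′ j , 1} (allFin n)) (∈-map⁺ P′ (∈-allFin j))

        isCoreset : IsCoreset X ε k z (unitWeights X P) (output algorithm mem)
        isCoreset = ≡.subst (IsCoreset X ε k z (unitWeights X P)) (≡.sym output≡)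
          (coreset x₀ (proj₁ 0<ε) isOpt weighted subset P≤result result≤P)

        private
          t : ℕ
          t = slack n

          t² : t ℕ.* t ℕ.≤ 256 ℕ.* (n ℕ.* K)
          t² = slack-square K (ℕ.≤-trans (ℕ.s≤s ℕ.z≤n) 2≤n) 1≤K n<m²K

          stored : ∀ i → length (mem i) ℕ.≤ t
          stored i = ℕ.≤-trans (ℕ.≤-reflexive (length-map (point ∘ P′) (machine a i))) (proj₂ (fair i))

          part≤t : ∀ i → length (part i) ℕ.≤ t
          part≤t i = ≡.subst (ℕ._≤ t) (length-map proj₁ (part i))
            (ℕ.≤-trans (Sublist.length-mono-≤ (net-sublist (net-part i)))
              (ℕ.≤-trans (ℕ.≤-reflexive (length-map P′ (machine a i))) (proj₂ (fair i))))

          -- At most t words are read, and a net of at most t points is sent with two words per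
          -- point.
          first-round : ∀ i → length (mem i) ℕ.+ 0 ℕ.+ sum (map (λ j → length (Step.send (step i (mem i)) j)) (allFin m)) ℕ.≤ 3 ℕ.* t
          first-round i = ℕ.≤-trans (ℕ.+-mono-≤ (ℕ.≤-trans (ℕ.≤-reflexive (ℕ.+-identityʳ _)) (stored i))
            (ℕ.≤-trans (ℕ.≤-reflexive (≡.trans (sum-head (λ j → length (Step.send (step i (mem i)) j)) (λ _ → ≡.refl)) (length-encode (part i))))
              (ℕ.*-monoʳ-≤ 2 (part≤t i)))) ℕ.≤-refl

        worker-memory : ∀ i → fromℕ (memoryUse algorithm mem (suc i)) ≤ fromℕ constant * T
        worker-memory i = ≤-trans (fromℕ-mono (ℕ.⊔-lub (first-round (suc i))
            (ℕ.≤-trans (length-concatMap-≤ (λ j → Step.send (step j (mem j)) (suc i)) 0 (λ _ → ℕ.z≤n) (allFin m))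
              (ℕ.≤-trans (ℕ.≤-reflexive (ℕ.*-zeroʳ (length (allFin m)))) ℕ.z≤n))))
          (within-T (3 ℕ.* t) (square-scale 3 {t} {n ℕ.* K} (ℕ.m≤m+n 3 3) t²))

        private
          -- Each net point costs two words on receipt and two in the output. The parameter `c`
          -- allows both size bounds, `t` and `K + share z`, which the two cases of
          -- `coordinator-bound` require.
          collected : ∀ c → (∀ i → length (part i) ℕ.≤ c) →
                      length (concatMap (encode ∘ part) (allFin m)) ℕ.+ 2 ℕ.* length (output algorithm mem) ℕ.≤ 4 ℕ.* (m ℕ.* c)
          collected c part≤c = ℕ.≤-trans (ℕ.+-mono-≤
              (bound (length-concatMap-≤ (encode ∘ part) (2 ℕ.* c)
                (λ i → ℕ.≤-trans (ℕ.≤-reflexive (length-encode (part i))) (ℕ.*-monoʳ-≤ 2 (part≤c i))) (allFin m)))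
              (ℕ.*-monoʳ-≤ 2 (ℕ.≤-trans (ℕ.≤-reflexive (≡.cong length output≡))
                (bound (length-concatMap-≤ part c part≤c (allFin m))))))
            (ℕ.≤-reflexive (eq m c))
            where
            bound : ∀ {x b} → x ℕ.≤ length (allFin m) ℕ.* b → x ℕ.≤ m ℕ.* b
            bound {b = b} h = ℕ.≤-trans h (ℕ.≤-reflexive (≡.cong (ℕ._* b) (length-allFin m)))
            eq : ∀ m c → m ℕ.* (2 ℕ.* c) ℕ.+ 2 ℕ.* (m ℕ.* c) ≡ 4 ℕ.* (m ℕ.* c)
            eq = solve-∀

        coordinator-memory : fromℕ (memoryUse algorithm mem zero) ≤ fromℕ constant * (T + S * fromℕ logTerm + fromℕ z)
        coordinator-memory =
          ≤-trans (fromℕ-mono (ℕ.⊔-lub (ℕ.≤-trans (first-round zero) (ℕ.≤-trans 3t≤M (ℕ.m≤m+n M _))) received≤))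
            (within-coordinator M M²≤)
          where
          bound : ∃ λ M → M ℕ.* M ℕ.≤ 96 ℕ.* 96 ℕ.* (n ℕ.* K) × 3 ℕ.* t ℕ.≤ M ×
                  length (concatMap (encode ∘ part) (allFin m)) ℕ.+ 2 ℕ.* length (output algorithm mem)
                    ℕ.≤ M ℕ.+ (88 ℕ.* (w ℕ.* logTerm) ℕ.+ 8 ℕ.* z)
          bound = coordinator-bound w {K} {n} {t} {share z} {logTerm} {z} w²K≤n 1≤K t² (share-total z 2≤n)
            (collected t part≤t) (collected (K ℕ.+ share z) part-size)
          M : ℕ
          M = proj₁ bound
          M²≤ = proj₁ (proj₂ bound)
          3t≤M = proj₁ (proj₂ (proj₂ bound))
          received≤ = proj₂ (proj₂ (proj₂ bound))

    Succeeds : Fin n ↣ Point → Vec (Fin m) n → Set ℓ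
    Succeeds P a = let mem = initialMemory P a in
      IsCoreset X ε k z (unitWeights X P) (output algorithm mem) ×
      (∀ (i : Fin w) → fromℕ (memoryUse algorithm mem (suc i)) ≤ fromℕ constant * T) ×
      fromℕ (memoryUse algorithm mem zero) ≤ fromℕ constant * (T + S * fromℕ logTerm + fromℕ z)

    highProbability : (P : Fin n ↣ Point) → WithHighProbability n (Succeeds P)
    highProbability P = cases (2 ℕ.≤? n)
      where
      w≤n : w ℕ.≤ n
      w≤n = ℕ.≤-trans (square w) (ℕ.≤-trans (ℕ.m≤m*n (w ℕ.* w) K ⦃ ℕ.>-nonZero 1≤K ⦄) w²K≤n)
        where
        square : ∀ w → w ℕ.≤ w ℕ.* w
        square zero    = ℕ.z≤n
        square (suc w) = ℕ.m≤m*n (suc w) (suc w)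
      cases : Dec (2 ℕ.≤ n) → WithHighProbability n (Succeeds P)
      -- For n ≤ 1 the factor n² is at most 1, so the required inequality holds without any good
      -- assignment.
      cases (no n≱2) = [] , [] , [] , ℕ.≤-trans
        (ℕ.*-monoˡ-≤ (m ℕ.^ n) (ℕ.^-monoˡ-≤ 2 (ℕ.≤-pred (ℕ.≰⇒> n≱2))))
        (ℕ.≤-trans (ℕ.≤-reflexive (ℕ.*-identityˡ (m ℕ.^ n))) (ℕ.m≤m+n (m ℕ.^ n) _))
      cases (yes 2≤n) = proj₁ fair , proj₁ (proj₂ fair) ,
        All.map (λ {a} → succeeds a) (proj₁ (proj₂ (proj₂ fair))) ,
        proj₂ (proj₂ (proj₂ fair))
        where
        open Run 2≤n P
        fair = balanced z Z ∣Z∣≤z 2≤n w≤n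
        succeeds : ∀ a → Balanced z Z a → Succeeds P a
        succeeds a fair = isCoreset a fair , worker-memory a fair , coordinator-memory a fair

theorem33 : ∀ {ℓ} (d : ℕ) → Σ ℕ λ C →
    (ℝ : CompleteOrderedField ℓ) → let open CompleteOrderedField ℝ in
    (X : MetricSpace ℝ) → let open MetricSpace X in
    HasDoublingDimension X d →
    (n k z : ℕ) → .{{_ : NonZero k}} →
    (ε : Carrier) → 0# < ε → ε ≤ 1# →
    let S = √ (fromℕ n * ε ^ d * fromℕ k ⁻¹)
        T = √ (fromℕ n * fromℕ k * (ε ^ d) ⁻¹)
    in
    Σ ℕ λ w → Σ (Algorithm Point (suc w) 1) λ alg →
    fromℕ w ≤ fromℕ C * S ×
    ((P : Fin n ↣ Point) → WithHighProbability n λ a →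
      let mem = initialMemory P a in
      IsCoreset X ε k z (unitWeights X P) (output alg mem) ×
      (∀ (i : Fin w) → fromℕ (memoryUse alg mem (suc i)) ≤ fromℕ C * T) ×
      fromℕ (memoryUse alg mem zero)
        ≤ fromℕ C * (T + S * fromℕ (⌊log₂ n ⌋ ⊓ z) + fromℕ z))
theorem33 d = 96 ℕ.* 2 ℕ.^ d , λ ℝ X (doubling , _) n k z ε 0<ε ε≤1 →
  let N = Scale.netSize-exists ℝ d n k (ℕ.>-nonZero⁻¹ k) ε 0<ε ε≤1
      w , w²K≤n , n<m²K = floor-root (Scale.NetSize.K N) (Scale.NetSize.1≤K N) n
  in w ,
     Construction.WithWorkers.algorithm X {d} doubling n k z ε 0<ε ε≤1 N w w²K≤n n<m²K ,
     Construction.WithWorkers.few-workers X {d} doubling n k z ε 0<ε ε≤1 N w w²K≤n n<m²K ,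
     Construction.WithWorkers.highProbability X {d} doubling n k z ε 0<ε ε≤1 N w w²K≤n n<m²K
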